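{- The problem Exact Matching in Red-Blue Bipartite Graphs is logspace reducible to the (decision version of the) Second Stage Recoverable Assignment Problem (2S-RecovAP).
   Context: Exact Matching in Red-Blue Bipartite Graphs: given a bipartite graph $G=(U\cup V,E)$, a subset $R\subseteq E$ of red edges and an integer $k$, decide whether $G$ has a perfect matching $M$ with $|M\cap R|=k$. 2S-RecovAP: given a bipartite graph $G$ (equivalently $K_{n,n}$ with cost $+\infty$ on non-edges) with a fixed perfect matching $M_1$, a cost function $c_2$ on the edges with values in $\mathbb{R}\cup\{+\infty\}$, and an integer $k$, find a perfect matching $M_2$ with $|M_1\cap M_2|\ge k$ minimizing $c_2(M_2)=\sum_{e\in M_2}c_2(e)$; the decision version additionally receives a bound $B$ and asks whether some such $M_2$ has $c_2(M_2)\le B$. -}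

module Defs where

open import Algebra.Bundles.Raw using (RawMonoid)
open import Algebra.Definitions.RawMonoid using (sum)
open import Data.Bool.Base using (Bool; true; false; T; _∧_; if_then_else_)
open import Data.Digit using (toDigits)
open import Data.Fin.Base using (Fin; zero; suc)
open import Data.Integer.Base as ℤ using (ℤ; +_; -[1+_])
open import Data.List.Base as List
  using (List; []; _∷_; _++_; [_]; length; map; concatMap; allFin; replicate)
open import Data.Maybe.Base using (Maybe; just; nothing)
open import Data.Nat.Base as ℕ using (ℕ; suc; _+_; _*_; _≤_)
open import Data.Nat.Logarithm using (⌊log₂_⌋)
open import Data.Product using (Σ-syntax; ∃-syntax; ∃!; _×_; _,_; proj₁)
open import Data.Rational.Base as ℚ using (ℚ; 0ℚ)
open import Data.Vec.Base as Vec using (Vec)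
open import Function.Bundles using (_↔_; _⇔_)
open import Level using (0ℓ)
open import Relation.Binary.PropositionalEquality using (_≡_; refl)
open import Relation.Nullary.Construct.Add.Supremum using (_⁺; ⊤⁺)
  renaming ([_] to fin)
import Relation.Binary.Construct.Add.Supremum.NonStrict as AddSup

Finite : Set → Set
Finite A = ∃[ n ] (A ↔ Fin n)

data Move : Set where
  left stay right : Move

-- The cells to the left of the head are listed starting from the head.

record Tape (A : Set) : Set where
  constructor _⟨_⟩_
  field
    before  : List A
    current : A
    after   : List A

open Tape public using (current)

write : {A : Set} → A → Tape A → Tape A
write x (l ⟨ _ ⟩ r) = l ⟨ x ⟩ r

-- On the input tape the head cannot leave the cells initially present.

moveInput : {A : Set} → Move → Tape A → Tape A
moveInput left  ([]      ⟨ x ⟩ r)       = [] ⟨ x ⟩ r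
moveInput left  ((y ∷ l) ⟨ x ⟩ r)       = l ⟨ y ⟩ (x ∷ r)
moveInput stay  t                       = t
moveInput right (l       ⟨ x ⟩ [])      = l ⟨ x ⟩ []
moveInput right (l       ⟨ x ⟩ (y ∷ r)) = (x ∷ l) ⟨ y ⟩ r

-- A work tape is infinite in both directions; only the cells visited so
-- far are stored, so that cells t is the space used on the tape.

moveWork : {A : Set} → A → Move → Tape A → Tape A
moveWork blank left  ([]      ⟨ x ⟩ r)       = [] ⟨ blank ⟩ (x ∷ r)
moveWork blank left  ((y ∷ l) ⟨ x ⟩ r)       = l ⟨ y ⟩ (x ∷ r)
moveWork blank stay  t                       = t
moveWork blank right (l       ⟨ x ⟩ [])      = (x ∷ l) ⟨ blank ⟩ []
moveWork blank right (l       ⟨ x ⟩ (y ∷ r)) = (x ∷ l) ⟨ y ⟩ r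

cells : {A : Set} → Tape A → ℕ
cells (l ⟨ _ ⟩ r) = length l + suc (length r)

-- Deterministic Turing transducers: a read-only two-way input tape, a
-- fixed number of work tapes, and a write-only one-way output tape.
-- The input is enclosed by the markers ⊢ and ⊣.

data InputCell (Γ : Set) : Set where
  ⊢ ⊣ : InputCell Γ
  sym : Γ → InputCell Γ

record Action (State Work Out : Set) (tapes : ℕ) : Set where
  field
    next      : State
    inputMove : Move
    writes    : Vec Work tapes
    workMoves : Vec Move tapes
    emit      : Maybe Out

record Transducer (In Out : Set) : Set₁ where
  field
    State       : Set
    stateFinite : Finite State
    start       : State
    Work        : Set
    workFinite  : Finite Work
    blank       : Work
    tapes       : ℕ
    -- The machine halts on nothing.
    δ           : State → InputCell In → Vec Work tapes →
                  Maybe (Action State Work Out tapes)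

module _ {In Out : Set} (M : Transducer In Out) where
  open Transducer M

  record Config : Set where
    field
      state : State
      input : Tape (InputCell In)
      works : Vec (Tape Work) tapes

  initial : List In → Config
  initial w = record
    { state = start
    ; input = [] ⟨ ⊢ ⟩ (map sym w ++ [ ⊣ ])
    ; works = Vec.replicate tapes ([] ⟨ blank ⟩ [])
    }

  action : Config → Maybe (Action State Work Out tapes)
  action c = δ state (current input) (Vec.map current works)
    where open Config c

  perform : Action State Work Out tapes → Config → Config
  perform a c = record
    { state = next
    ; input = moveInput inputMove input
    ; works = Vec.zipWith (moveWork blank) workMoves
                (Vec.zipWith write writes works)
    }
    where
    open Action a
    open Config c

  -- Only the work tapes are charged.
  space : Config → ℕ
  space c = Vec.sum (Vec.map cells (Config.works c))

  emitted : Maybe Out → List Out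
  emitted nothing  = []
  emitted (just x) = [ x ]

  -- Run s c w: started in c, the machine halts after writing w, and no
  -- configuration it passes through uses more than s cells.
  data Run (s : ℕ) (c : Config) : List Out → Set where
    halt : space c ≤ s → action c ≡ nothing → Run s c []
    step : ∀ {a w} → space c ≤ s → action c ≡ just a →
           Run s (perform a c) w → Run s c (emitted (Action.emit a) ++ w)

record DecisionProblem : Set₁ where
  field
    Symbol       : Set
    symbolFinite : Finite Symbol
    Instance     : Set
    encode       : Instance → List Symbol
    Yes          : Instance → Set

module _ (A B : DecisionProblem) where
  private
    module A = DecisionProblem A
    module B = DecisionProblem B

  -- The bound c * (1 + log n) is O(log n) and also makes sense for n ≤ 1.
  LogspaceComputable : (A.Instance → B.Instance) → Set₁
  LogspaceComputable f =
    Σ[ M ∈ Transducer A.Symbol B.Symbol ] ∃[ c ]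
      (∀ x → Run M (c * suc ⌊log₂ length (A.encode x) ⌋)
                   (initial M (A.encode x)) (B.encode (f x)))

  LogspaceReducible : Set₁
  LogspaceReducible =
    Σ[ f ∈ (A.Instance → B.Instance) ]
      LogspaceComputable f × (∀ x → A.Yes x ⇔ B.Yes (f x))

-- Sets of edges of a bipartite graph with sides Fin m and Fin n.

EdgeSet : ℕ → ℕ → Set
EdgeSet m n = Fin m → Fin n → Bool

module _ {m n : ℕ} where

  _⊆_ : EdgeSet m n → EdgeSet m n → Set
  E ⊆ F = ∀ u v → T (E u v) → T (F u v)

  _∩_ : EdgeSet m n → EdgeSet m n → EdgeSet m n
  (E ∩ F) u v = E u v ∧ F u v

  sumOver : (𝓜 : RawMonoid 0ℓ 0ℓ) → EdgeSet m n →
            (Fin m → Fin n → RawMonoid.Carrier 𝓜) → RawMonoid.Carrier 𝓜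
  sumOver 𝓜 E w =
    sum 𝓜 λ u → sum 𝓜 λ v → if E u v then w u v else RawMonoid.ε 𝓜

  ∣_∣ : EdgeSet m n → ℕ
  ∣ E ∣ = sumOver ℕ.+-0-rawMonoid E (λ _ _ → 1)

  record IsPerfectMatching (E M : EdgeSet m n) : Set where
    field
      subset  : M ⊆ E
      coversˡ : ∀ u → ∃! _≡_ λ v → T (M u v)
      coversʳ : ∀ v → ∃! _≡_ λ u → T (M u v)

complete : ∀ n → EdgeSet n n
complete n _ _ = true

data Sym : Set where
  𝟎 𝟏 minus slash inf sep : Sym

Sym-finite : Finite Sym
Sym-finite = 6 , record
  { to        = to
  ; from      = from
  ; to-cong   = λ { refl → refl }
  ; from-cong = λ { refl → refl }
  ; inverse   = (λ { {x} refl → to∘from x })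
              , (λ { {x} refl → from∘to x })
  }
  where
  to : Sym → Fin 6
  to 𝟎     = zero
  to 𝟏     = suc zero
  to minus = suc (suc zero)
  to slash = suc (suc (suc zero))
  to inf   = suc (suc (suc (suc zero)))
  to sep   = suc (suc (suc (suc (suc zero))))

  from : Fin 6 → Sym
  from zero                               = 𝟎
  from (suc zero)                         = 𝟏
  from (suc (suc zero))                   = minus
  from (suc (suc (suc zero)))             = slash
  from (suc (suc (suc (suc zero))))       = inf
  from (suc (suc (suc (suc (suc zero))))) = sep

  to∘from : ∀ i → to (from i) ≡ i
  to∘from zero                               = refl
  to∘from (suc zero)                         = refl
  to∘from (suc (suc zero))                   = refl
  to∘from (suc (suc (suc zero)))             = refl
  to∘from (suc (suc (suc (suc zero))))       = refl
  to∘from (suc (suc (suc (suc (suc zero))))) = refl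

  from∘to : ∀ x → from (to x) ≡ x
  from∘to 𝟎     = refl
  from∘to 𝟏     = refl
  from∘to minus = refl
  from∘to slash = refl
  from∘to inf   = refl
  from∘to sep   = refl

encodeBool : Bool → Sym
encodeBool false = 𝟎
encodeBool true  = 𝟏

encodeBit : Fin 2 → Sym
encodeBit zero    = 𝟎
encodeBit (suc _) = 𝟏

-- Numbers are written in binary, least significant digit first.

encodeℕ : ℕ → List Sym
encodeℕ n = map encodeBit (proj₁ (toDigits 2 n))

encodeℤ : ℤ → List Sym
encodeℤ (+ n)    = encodeℕ n
encodeℤ -[1+ n ] = minus ∷ encodeℕ (suc n)

encodeℚ : ℚ → List Sym
encodeℚ q = encodeℤ (ℚ.↥ q) ++ slash ∷ encodeℕ (ℚ.↧ₙ q)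

encodeMatrix : ∀ {m n} → (Fin m → Fin n → List Sym) → List Sym
encodeMatrix {m} {n} e =
  concatMap (λ u → concatMap (e u) (allFin n) ++ [ sep ]) (allFin m)

record RedBlueGraph : Set where
  field
    {m n} : ℕ
    E     : EdgeSet m n
    R     : EdgeSet m n
    R⊆E   : R ⊆ E
    k     : ℤ

-- The vertices are listed in unary before the adjacency matrix, as the
-- matrix alone does not determine n when m ≡ 0.

ExactMatching : DecisionProblem
ExactMatching = record
  { Symbol       = Sym
  ; symbolFinite = Sym-finite
  ; Instance     = RedBlueGraph
  ; encode       = λ G → let open RedBlueGraph G in
      replicate m 𝟏 ++ sep ∷ replicate n 𝟏 ++ sep ∷
      encodeMatrix (λ u v → encodeBool (E u v) ∷ encodeBool (R u v) ∷ []) ++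
      encodeℤ k
  ; Yes          = λ G → let open RedBlueGraph G in
      ∃[ M ] (IsPerfectMatching E M × + ∣ M ∩ R ∣ ≡ k)
  }

-- Costs in the input of a machine are rational, or +∞.

Cost : Set
Cost = ℚ ⁺

open AddSup ℚ._≤_ public using (_≤⁺_)

_+⁺_ : Cost → Cost → Cost
fin p +⁺ fin q = fin (p ℚ.+ q)
fin _ +⁺ ⊤⁺    = ⊤⁺
⊤⁺    +⁺ _     = ⊤⁺

+⁺-rawMonoid : RawMonoid 0ℓ 0ℓ
+⁺-rawMonoid = record
  { Carrier = Cost
  ; _≈_     = _≡_
  ; _∙_     = _+⁺_
  ; ε       = fin 0ℚ
  }

encodeCost : Cost → List Sym
encodeCost (fin q) = encodeℚ q
encodeCost ⊤⁺      = [ inf ]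

-- The graph is K_{n,n}; pairs that are not to be used have cost +∞.

record RecovAPInstance : Set where
  field
    {n}        : ℕ
    M₁         : EdgeSet n n
    M₁-perfect : IsPerfectMatching (complete n) M₁
    c₂         : Fin n → Fin n → Cost
    k          : ℤ
    B          : ℚ

2S-RecovAP : DecisionProblem
2S-RecovAP = record
  { Symbol       = Sym
  ; symbolFinite = Sym-finite
  ; Instance     = RecovAPInstance
  ; encode       = λ I → let open RecovAPInstance I in
      replicate n 𝟏 ++ sep ∷
      encodeMatrix (λ u v → encodeBool (M₁ u v) ∷ encodeCost (c₂ u v) ++ [ sep ]) ++
      encodeℤ k ++ sep ∷ encodeℚ B
  ; Yes          = λ I → let open RecovAPInstance I in
      ∃[ M₂ ] (IsPerfectMatching (complete n) M₂
               × k ℤ.≤ + ∣ M₁ ∩ M₂ ∣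
               × sumOver +⁺-rawMonoid M₂ c₂ ≤⁺ fin B)
  }

{-# OPTIONS --safe #-}
module Submission where

-- Every vertex u ∈ U is split into two copies, joined to a common new
-- vertex a; the first copy takes the blue edges at u and the second the
-- red ones.  So u is matched along a red edge exactly when its first copy
-- is matched to a.  This edge has cost 1 and lies in M₁, and every other
-- edge of M₁ has cost +∞ while every other edge not of cost +∞ has cost 0.
-- Hence the cost of M₂ and ∣ M₁ ∩ M₂ ∣ both are the number of red edges
-- used, and k serves both as the lower bound on the one and as the upper
-- bound on the other.
--
-- The new instance is written by a program with a single counter, which
-- never exceeds the number of vertices plus two: a loop over vertices keeps
-- its index as the head position in the unary part of the input, and the
-- counter only saves that position while the head is elsewhere.

open import Defs
open import Data.Bool.Base using (Bool; true; false; if_then_else_; not; _∧_; _∨_; T)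
open import Data.Bool.Properties using (T-∨; T-≡; ∧-zeroʳ; ∧-identityʳ)
open import Algebra.Definitions.RawMonoid using (sum)
open import Data.Digit using (toDigits)
open import Data.Empty using (⊥; ⊥-elim)
open import Data.Fin.Base using (Fin; zero; suc; toℕ; splitAt; join; _↑ˡ_; _↑ʳ_)
open import Data.Fin.Properties
  using (_≟_; toℕ<n; splitAt-↑ˡ; splitAt-↑ʳ; join-splitAt; 0≢1+n; suc-injective; +↔⊎; 1↔⊤)
open import Data.Integer.Base as ℤ using (ℤ)
import Data.Integer.Properties as ℤ
open import Data.List.Base
  using (List; []; _∷_; [_]; _++_; map; length; replicate; concat; concatMap; tabulate; _ʳ++_; reverse)
open import Data.List.Properties
  using (++-assoc; ++-identityʳ; ʳ++-ʳ++; ++-ʳ++; ʳ++-defn; reverse-involutive; length-++; length-replicate)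
open import Data.List.Relation.Unary.All using (All; []; _∷_)
open import Data.Maybe.Base using (Maybe; just; nothing)
open import Data.Nat.Base as ℕ
  using (ℕ; zero; suc; _+_; _*_; _∸_; _^_; _≤_; _<_; _<ᵇ_; z≤n; s≤s)
open import Data.Nat.Logarithm using (⌊log₂_⌋; ⌊log₂⌋-mono-≤; ⌊log₂[2^n]⌋≡n)
open import Data.Nat.Properties hiding (_≟_; 0≢1+n; suc-injective)
open import Data.Product.Base using (∃-syntax; _×_; _,_; proj₁; proj₂; map₂)
open import Data.Rational.Base as ℚ using (0ℚ)
open import Data.Rational.Literals using (fromℤ)
import Data.Rational.Properties as ℚ
import Data.Rational.Unnormalised.Base as ℚᵘ
import Data.Rational.Unnormalised.Properties as ℚᵘ
open import Data.Sum.Base as Sum using (_⊎_; inj₁; inj₂; [_,_]′)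
open import Data.Sum.Function.Propositional using (_⊎-↔_)
open import Data.Unit.Base using (⊤; tt)
open import Data.Vec.Base as Vec using (Vec)
open import Function.Base using (_∘_; const; id)
open import Function.Bundles using (_⇔_; mk⇔; mk↔ₛ′; Equivalence)
open import Function.Construct.Composition using (_↔-∘_)
open import Function.Construct.Symmetry using (↔-sym)
import Relation.Binary.Construct.Add.Supremum.NonStrict as AddSup
open import Relation.Binary.PropositionalEquality
  using (_≡_; refl; trans; cong; cong₂; subst; subst₂; module ≡-Reasoning) renaming (sym to ≡-sym)
open import Relation.Nullary.Construct.Add.Supremum using (⊤⁺) renaming ([_] to fin)
open import Relation.Nullary.Decidable using (does; yes; dec-true)
open import Relation.Nullary.Negation.Core using (¬_; contradiction)

-- While programs and their compilation to transducers

-- Both sides of the new graph have `m + (m + n)` vertices whatever `m` and `n` are, so unbalanced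
-- input graphs need no separate treatment: they have no perfect matching, and the new graph then
-- has none of finite cost. Negative `k` takes care of itself in the same way, since a finite cost
-- is always a natural number here. As `k` becomes both bounds unchanged, its digits are copied and
-- never computed with.
--
-- On the machine side the obstacle is that every configuration has to obey the space bound, not
-- only the last one, while the program has to be put together from small pieces. The pieces are
-- therefore written as while programs whose big-step semantics demands the bound at each step, and
-- a compiler, verified once, turns a derivation into a run of a transducer. The counter needs about
-- as many cells as a number below the input length has binary digits, which is where the logarithm
-- comes from.

Finite-⊤ : Finite ⊤
Finite-⊤ = 1 , ↔-sym 1↔⊤

Finite-⊎ : ∀ {A B} → Finite A → Finite B → Finite (A ⊎ B)
Finite-⊎ (m , A↔) (n , B↔) = m + n , (↔-sym +↔⊎ ↔-∘ (A↔ ⊎-↔ B↔))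

module While {In Out W : Set} (W-finite : Finite W) (blank : W) where

  record Instruction : Set where
    constructor instruction
    field
      emitting  : Maybe Out
      inputMove : Move
      writing   : W
      workMove  : Move

  Test : Set
  Test = InputCell In → W → Bool

  infixr 5 _⨾_

  data Program : Set where
    basic  : (InputCell In → W → Instruction) → Program
    _⨾_    : Program → Program → Program
    branch : Test → Program → Program → Program
    loop   : Test → Program → Program

  State : Set
  State = Tape (InputCell In) × Tape W

  emission : Maybe Out → List Out
  emission nothing  = []
  emission (just x) = x ∷ []

  execute : Instruction → State → State
  execute (instruction _ μ x ν) (i , t) = moveInput μ i , moveWork blank ν (write x t)

  seen : {A : Set} → (InputCell In → W → A) → State → A
  seen f (i , t) = f (current i) (current t)

  module _ (s : ℕ) where

    infix 4 _⊢_⇒_!_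

    -- The premise on `cells` occurs once for each configuration in which the compiled machine makes
    -- a step: at every basic instruction and at every evaluation of a test. Only the halting
    -- configuration is missing; `compile-correct` asks for it separately.
    data _⊢_⇒_!_ : Program → State → State → List Out → Set where
      basic  : ∀ {a σ} → cells (proj₂ σ) ≤ s →
               basic a ⊢ σ ⇒ execute (seen a σ) σ ! emission (Instruction.emitting (seen a σ))
      _⨾_    : ∀ {p q ρ σ τ v w} → p ⊢ ρ ⇒ σ ! v → q ⊢ σ ⇒ τ ! w →
               (p ⨾ q) ⊢ ρ ⇒ τ ! v ++ w
      branch : ∀ {b p q σ τ w} → cells (proj₂ σ) ≤ s →
               (if seen b σ then p else q) ⊢ σ ⇒ τ ! w → branch b p q ⊢ σ ⇒ τ ! w
      exit   : ∀ {b p σ} → cells (proj₂ σ) ≤ s → seen b σ ≡ false →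
               loop b p ⊢ σ ⇒ σ ! []
      again  : ∀ {b p ρ σ τ v w} → cells (proj₂ ρ) ≤ s → seen b ρ ≡ true →
               p ⊢ ρ ⇒ σ ! v → loop b p ⊢ σ ⇒ τ ! w → loop b p ⊢ ρ ⇒ τ ! v ++ w

  -- These become the control states: one for each basic instruction and one for each test, whereas
  -- sequencing costs no state and no step.
  Point : Program → Set
  Point (basic _)      = ⊤
  Point (p ⨾ q)        = Point p ⊎ Point q
  Point (branch _ p q) = ⊤ ⊎ (Point p ⊎ Point q)
  Point (loop _ p)     = ⊤ ⊎ Point p

  Point-finite : ∀ p → Finite (Point p)
  Point-finite (basic _)      = Finite-⊤
  Point-finite (p ⨾ q)        = Finite-⊎ (Point-finite p) (Point-finite q)
  Point-finite (branch _ p q) = Finite-⊎ Finite-⊤ (Finite-⊎ (Point-finite p) (Point-finite q))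
  Point-finite (loop _ p)     = Finite-⊎ Finite-⊤ (Point-finite p)

  entry : ∀ p → Point p
  entry (basic _)      = tt
  entry (p ⨾ q)        = inj₁ (entry p)
  entry (branch _ p q) = inj₁ tt
  entry (loop _ p)     = inj₁ tt

  idle : W → Instruction
  idle x = instruction nothing stay x stay

  -- The successor inj₁ tt stands for leaving the program.
  next : ∀ p → Point p → InputCell In → W → Instruction × (⊤ ⊎ Point p)
  next (basic a) _ c x = a c x , inj₁ tt
  next (p ⨾ q) (inj₁ l) c x =
    map₂ (inj₂ ∘ [ const (inj₂ (entry q)) , inj₁ ]′) (next p l c x)
  next (p ⨾ q) (inj₂ l) c x = map₂ [ inj₁ , inj₂ ∘ inj₂ ]′ (next q l c x)
  next (branch b p q) (inj₁ _) c x =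
    idle x , inj₂ (inj₂ (if b c x then inj₁ (entry p) else inj₂ (entry q)))
  next (branch b p q) (inj₂ (inj₁ l)) c x =
    map₂ [ inj₁ , inj₂ ∘ inj₂ ∘ inj₁ ]′ (next p l c x)
  next (branch b p q) (inj₂ (inj₂ l)) c x =
    map₂ [ inj₁ , inj₂ ∘ inj₂ ∘ inj₂ ]′ (next q l c x)
  next (loop b p) (inj₁ _) c x =
    idle x , (if b c x then inj₂ (inj₂ (entry p)) else inj₁ tt)
  next (loop b p) (inj₂ l) c x = map₂ (inj₂ ∘ [ inj₁ , inj₂ ]′) (next p l c x)

  module _ (P : Program) where

    toAction : Instruction → ⊤ ⊎ Point P → Action (⊤ ⊎ Point P) W Out 1
    toAction (instruction e μ x ν) l = record
      { next      = l
      ; inputMove = μ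
      ; writes    = x Vec.∷ Vec.[]
      ; workMoves = ν Vec.∷ Vec.[]
      ; emit      = e
      }

    compile : Transducer In Out
    compile = record
      { State       = ⊤ ⊎ Point P
      ; stateFinite = Finite-⊎ Finite-⊤ (Point-finite P)
      ; start       = inj₂ (entry P)
      ; Work        = W
      ; workFinite  = W-finite
      ; blank       = blank
      ; tapes       = 1
      ; δ           = δ
      }
      where
      δ : ⊤ ⊎ Point P → InputCell In → Vec W 1 → Maybe (Action (⊤ ⊎ Point P) W Out 1)
      δ (inj₁ _) c _            = nothing
      δ (inj₂ l) c (x Vec.∷ _) = just (toAction (proj₁ (next P l c x)) (proj₂ (next P l c x)))

    config : ⊤ ⊎ Point P → State → Config compile
    config l (i , t) = record { state = l ; input = i ; works = t Vec.∷ Vec.[] }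

    -- The program p sits inside P at the points κ, and e is where P
    -- continues after p.
    Embedded : ∀ p → (Point p → ⊤ ⊎ Point P) → ⊤ ⊎ Point P → Set
    Embedded p κ e = ∀ l c x → Transducer.δ compile (κ l) c (x Vec.∷ Vec.[]) ≡
      just (toAction (proj₁ (next p l c x)) ([ const e , κ ]′ (proj₂ (next p l c x))))

    -- One argument for the five ways in which a program sits directly inside another: `f` places
    -- the points and `g` the successors. In each use the three side conditions hold by definition
    -- of `next`.
    subprogram : ∀ p q κ e (f : Point q → Point p) (g : ⊤ ⊎ Point q → ⊤ ⊎ Point p) e′ →
                 (∀ l c x → next p (f l) c x ≡ map₂ g (next q l c x)) →
                 [ const e , κ ]′ (g (inj₁ tt)) ≡ e′ →
                 (∀ l → [ const e , κ ]′ (g (inj₂ l)) ≡ κ (f l)) →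
                 Embedded p κ e → Embedded q (κ ∘ f) e′
    subprogram p q κ e f g e′ eq leave remain emb l c x rewrite emb (f l) c x | eq l c x =
      cong (just ∘ toAction _) (continue (proj₂ (next q l c x)))
      where
      continue : ∀ l → [ const e , κ ]′ (g l) ≡ [ const e′ , κ ∘ f ]′ l
      continue (inj₁ _) = leave
      continue (inj₂ l) = remain l

    module _ {s : ℕ} where

      fits : (t : Tape W) → cells t ≤ s → cells t + 0 ≤ s
      fits t = subst (_≤ s) (≡-sym (+-identityʳ (cells t)))

      emitted≡emission : ∀ e → emitted compile e ≡ emission e
      emitted≡emission nothing  = refl
      emitted≡emission (just _) = refl

      simulate-basic : ∀ {l σ w} a l′ → cells (proj₂ σ) ≤ s →
                       action compile (config l σ) ≡ just (toAction a l′) →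
                       Run compile s (config l′ (execute a σ)) w →
                       Run compile s (config l σ) (emission (Instruction.emitting a) ++ w)
      simulate-basic {l} {σ} {w} a@(instruction e _ _ _) l′ σ≤s eq r =
        subst (λ v → Run compile s (config l σ) (v ++ w)) (emitted≡emission e)
          (step (fits (proj₂ σ) σ≤s) eq r)

      write-current : (t : Tape W) → write (current t) t ≡ t
      write-current (_ ⟨ _ ⟩ _) = refl

      simulate-idle : ∀ {l σ w} l′ → cells (proj₂ σ) ≤ s →
                      action compile (config l σ) ≡ just (toAction (idle (current (proj₂ σ))) l′) →
                      Run compile s (config l′ σ) w → Run compile s (config l σ) w
      simulate-idle {σ = i , t} {w} l′ σ≤s eq r = simulate-basic (idle (current t)) l′ σ≤s eq
        (subst (λ u → Run compile s (config l′ (i , u)) w) (≡-sym (write-current t)) r)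

      -- A `Run` is extended at its front, so the run that follows `p` is an argument and the steps
      -- of `p` are prepended to it. Sequencing then becomes nesting, and the body of a loop has the
      -- test point of that loop as its exit.
      simulate : ∀ p κ e {σ τ v w} → Embedded p κ e → _⊢_⇒_!_ s p σ τ v →
                 Run compile s (config e τ) w →
                 Run compile s (config (κ (entry p)) σ) (v ++ w)
      simulate (basic _) κ e emb (basic σ≤s) r = simulate-basic _ e σ≤s (emb tt _ _) r
      simulate (p ⨾ q) κ e {ρ} {w = w} emb (_⨾_ {v = v} {w′} x y) r =
        subst (Run compile s (config (κ (inj₁ (entry p))) ρ)) (≡-sym (++-assoc v w′ w))
          (simulate p (κ ∘ inj₁) (κ (inj₂ (entry q)))
            (subprogram (p ⨾ q) p κ e inj₁ (inj₂ ∘ [ const (inj₂ (entry q)) , inj₁ ]′) _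
              (λ _ _ _ → refl) refl (λ _ → refl) emb) x
            (simulate q (κ ∘ inj₂) e
              (subprogram (p ⨾ q) q κ e inj₂ [ inj₁ , inj₂ ∘ inj₂ ]′ _
                (λ _ _ _ → refl) refl (λ _ → refl) emb) y r))
      simulate (branch b p q) κ e {i , t} emb (branch σ≤s x) r
        with b (current i) (current t) | emb (inj₁ tt) (current i) (current t)
      ... | true  | eq = simulate-idle (κ (inj₂ (inj₁ (entry p)))) σ≤s eq
        (simulate p (κ ∘ inj₂ ∘ inj₁) e
          (subprogram (branch b p q) p κ e (inj₂ ∘ inj₁) [ inj₁ , inj₂ ∘ inj₂ ∘ inj₁ ]′ _
            (λ _ _ _ → refl) refl (λ _ → refl) emb) x r)
      ... | false | eq = simulate-idle (κ (inj₂ (inj₂ (entry q)))) σ≤s eq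
        (simulate q (κ ∘ inj₂ ∘ inj₂) e
          (subprogram (branch b p q) q κ e (inj₂ ∘ inj₂) [ inj₁ , inj₂ ∘ inj₂ ∘ inj₂ ]′ _
            (λ _ _ _ → refl) refl (λ _ → refl) emb) x r)
      simulate (loop b p) κ e {i , t} emb (exit σ≤s eq) r =
        simulate-idle e σ≤s (trans (emb (inj₁ tt) _ _) (cong next-action eq)) r
        where
        next-action = λ z → just (toAction (idle (current t))
          ([ const e , κ ]′ (if z then inj₂ (inj₂ (entry p)) else inj₁ tt)))
      simulate (loop b p) κ e {i , t} {w = w} emb (again {v = v} {w′} σ≤s eq x y) r =
        subst (Run compile s (config (κ (inj₁ tt)) (i , t))) (≡-sym (++-assoc v w′ w))
          (simulate-idle (κ (inj₂ (entry p))) σ≤s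
            (trans (emb (inj₁ tt) _ _) (cong next-action eq))
            (simulate p (κ ∘ inj₂) (κ (inj₁ tt))
              (subprogram (loop b p) p κ e inj₂ (inj₂ ∘ [ inj₁ , inj₂ ]′) _
                (λ _ _ _ → refl) refl (λ _ → refl) emb) x
              (simulate (loop b p) κ e emb y r)))
        where
        next-action = λ z → just (toAction (idle (current t))
          ([ const e , κ ]′ (if z then inj₂ (inj₂ (entry p)) else inj₁ tt)))

      compile-correct : ∀ {σ τ v} → _⊢_⇒_!_ s P σ τ v → cells (proj₂ τ) ≤ s →
                        Run compile s (config (inj₂ (entry P)) σ) v
      compile-correct {τ = i , t} {v} x τ≤s =
        subst (Run compile s _) (++-identityʳ v)
          (simulate P inj₂ (inj₁ tt)
            (λ l c y → cong (just ∘ toAction _) (η (proj₂ (next P l c y)))) x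
            (halt (fits t τ≤s) refl))
        where
        η : (l : ⊤ ⊎ Point P) → l ≡ [ const (inj₁ tt) , inj₂ ]′ l
        η (inj₁ _) = refl
        η (inj₂ _) = refl

-- A binary counter

data Digit : Set where
  ␣ ① ② : Digit

Digit-finite : Finite Digit
Digit-finite = 3 , mk↔ₛ′
  (λ { ␣ → zero ; ① → suc zero ; ② → suc (suc zero) })
  (λ { zero → ␣ ; (suc zero) → ① ; (suc (suc zero)) → ② })
  (λ { zero → refl ; (suc zero) → refl ; (suc (suc zero)) → refl })
  (λ { ␣ → refl ; ① → refl ; ② → refl })

open While {Sym} {Sym} Digit-finite ␣

-- With this recursion `double (suc v)` unfolds to `suc (suc (double v))`, which makes the
-- arithmetic of carrying and borrowing hold by computation.
double : ℕ → ℕ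
double zero    = zero
double (suc n) = suc (suc (double n))

double≡2* : ∀ n → double n ≡ 2 * n
double≡2* zero    = refl
double≡2* (suc n) = cong suc (trans (cong suc (double≡2* n)) (≡-sym (+-suc n (n + 0))))

-- Bijective base 2, least significant digit first, padded with blanks:
-- zero is the only number whose first cell is blank.
data Numeral : ℕ → List Digit → Set where
  nil : Numeral 0 []
  pad : ∀ {xs} → Numeral 0 xs → Numeral 0 (␣ ∷ xs)
  one : ∀ {v xs} → Numeral v xs → Numeral (suc (double v)) (① ∷ xs)
  two : ∀ {v xs} → Numeral v xs → Numeral (suc (suc (double v))) (② ∷ xs)

is① is② nonblank : Digit → Bool
is① ① = true
is① _ = false
is② ② = true
is② _ = false
nonblank ␣ = false
nonblank _ = true

onWork : (Digit → Digit) → Move → Program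
onWork f μ = basic (λ _ x → instruction nothing stay (f x) μ)

keep : Digit → Digit
keep x = x

-- In bijective base 2 a carry turns ② into ①, as 2 + 1 = 1 + 2 · 1, and a borrow turns ① into ②, as
-- 1 - 1 = 2 - 2 · 1. The blank to the left of the first digit is the marker by which `rewind` finds
-- its way back.
rewind increment decrement : Program
rewind = loop (λ _ → nonblank) (onWork keep left) ⨾ onWork keep right
increment =
  loop (λ _ → is②) (onWork (λ _ → ①) right) ⨾
  onWork (λ x → if nonblank x then ② else ①) left ⨾
  rewind
-- Borrowing past the last digit leaves a ② there, which is then erased.
decrement =
  loop (λ _ → is①) (onWork (λ _ → ②) right) ⨾
  branch (λ _ → is②)
    (onWork (λ _ → ①) left)
    (onWork keep left ⨾ onWork (λ _ → ␣) left) ⨾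
  rewind

focus : List Digit → List Digit → Tape Digit
focus l []       = l ⟨ ␣ ⟩ []
focus l (x ∷ xs) = l ⟨ x ⟩ xs

digit : Bool → Digit
digit false = ①
digit true  = ②

-- The cells between the blank left of the counter and the head.
passed : List Bool → List Digit
passed ds = map digit ds ++ [ ␣ ]

leftOf : List Bool → List Digit → Tape Digit
leftOf []       xs = [] ⟨ ␣ ⟩ xs
leftOf (d ∷ ds) xs = passed ds ⟨ digit d ⟩ xs

unwind : List Bool → List Digit → List Digit
unwind []       xs = xs
unwind (d ∷ ds) xs = unwind ds (digit d ∷ xs)

moveWork-left : ∀ ds x xs → moveWork ␣ left (passed ds ⟨ x ⟩ xs) ≡ leftOf ds (x ∷ xs)
moveWork-left []       x xs = refl
moveWork-left (d ∷ ds) x xs = refl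

moveWork-right : ∀ l x xs → moveWork ␣ right (l ⟨ x ⟩ xs) ≡ focus (x ∷ l) xs
moveWork-right l x []      = refl
moveWork-right l x (_ ∷ _) = refl

length-passed : ∀ ds → length (passed ds) ≡ suc (length ds)
length-passed []       = refl
length-passed (d ∷ ds) = cong suc (length-passed ds)

nonblank-digit : ∀ d → nonblank (digit d) ≡ true
nonblank-digit false = refl
nonblank-digit true  = refl

module _ {s : ℕ} where

  private
    infix 4 _⊢ᵂ_⇒_
    _⊢ᵂ_⇒_ : Program → Tape Digit → Tape Digit → Set
    p ⊢ᵂ t ⇒ t′ = ∀ i → _⊢_⇒_!_ s p (i , t) (i , t′) []

  onWork-run : ∀ {f μ t t′} → cells t ≤ s → moveWork ␣ μ (write (f (current t)) t) ≡ t′ →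
               onWork f μ ⊢ᵂ t ⇒ t′
  onWork-run {f} {μ} {t} t≤s refl i = basic {a = λ _ x → instruction nothing stay (f x) μ} t≤s

  leftOf-fits : ∀ ds xs → length ds + length xs < s → cells (leftOf ds xs) ≤ s
  leftOf-fits []       xs p = p
  leftOf-fits (d ∷ ds) xs p rewrite length-passed ds =
    subst (λ z → suc z ≤ s) (≡-sym (+-suc (length ds) (length xs))) p

  rewind-loop : ∀ ds xs → length ds + length xs < s →
                loop (λ _ → nonblank) (onWork keep left) ⊢ᵂ leftOf ds xs ⇒
                ([] ⟨ ␣ ⟩ unwind ds xs)
  rewind-loop []       xs p i = exit p refl
  rewind-loop (d ∷ ds) xs p i =
    again (leftOf-fits (d ∷ ds) xs p) (nonblank-digit d)
      (onWork-run {keep} (leftOf-fits (d ∷ ds) xs p) (moveWork-left ds (digit d) xs) i)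
      (rewind-loop ds (digit d ∷ xs) (subst (_< s) (≡-sym (+-suc (length ds) (length xs))) p) i)

  length-unwind : ∀ ds xs → length (unwind ds xs) ≡ length ds + length xs
  length-unwind []       xs = refl
  length-unwind (d ∷ ds) xs = trans (length-unwind ds (digit d ∷ xs)) (+-suc (length ds) (length xs))

  rewind-run : ∀ ds xs → length ds + length xs < s →
               rewind ⊢ᵂ leftOf ds xs ⇒ focus [ ␣ ] (unwind ds xs)
  rewind-run ds xs p i =
    rewind-loop ds xs p i ⨾
    onWork-run {keep} (subst (_< s) (≡-sym (length-unwind ds xs)) p)
      (moveWork-right [] ␣ (unwind ds xs)) i

  -- Two cells may be in use besides the digits: the blank marker on the left and, once `xs` is
  -- exhausted, the cell under the head.
  focus-fits : ∀ ds xs → suc (length ds + length xs) < s → cells (focus (passed ds) xs) ≤ s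
  focus-fits ds []       p rewrite length-passed ds | +-comm (length ds) 1 | +-identityʳ (length ds) = p
  focus-fits ds (x ∷ xs) p rewrite length-passed ds = <⇒≤ p

  halve-< : ∀ {v k} → double v < 2 ^ suc k → v < 2 ^ k
  halve-< {v} {k} p = *-cancelˡ-< 2 v (2 ^ k) (subst (_< 2 ^ suc k) (double≡2* v) p)

  push : ∀ {d k : ℕ} → suc (d + suc k) < s → suc (suc d + k) < s
  push {d} {k} = subst (λ z → suc z < s) (+-suc d k)

  below : ∀ {d k n : ℕ} → n ≤ k → suc (d + k) < s → suc (d + n) < s
  below {d} p q = ≤-<-trans (s≤s (+-monoʳ-≤ d p)) q

  -- The head stands in the middle of the numeral, behind the digits `ds` already rewritten, and
  -- `run` covers the remaining turns of the loop together with all that follows it. In this form a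
  -- carry or borrow is an induction on the numeral, with `unroll` adding one turn in front.
  record Updated (p : Program) (ds : List Bool) (xs : List Digit) (v k : ℕ) : Set where
    field
      digits : List Digit
      value  : Numeral v digits
      short  : length digits ≤ k
      run    : p ⊢ᵂ focus (passed ds) xs ⇒ focus [ ␣ ] (unwind ds digits)

  unroll : ∀ {b p q ρ σ τ w} → cells (proj₂ ρ) ≤ s → seen b ρ ≡ true →
           _⊢_⇒_!_ s p ρ σ [] → _⊢_⇒_!_ s (loop b p ⨾ q) σ τ w →
           _⊢_⇒_!_ s (loop b p ⨾ q) ρ τ w
  unroll ρ≤s eq x (y ⨾ z) = again ρ≤s eq x y ⨾ z

  -- Each carry halves the number and uses up one of the `k` cells; since the new value stays below
  -- `2 ^ k`, a cell is left when the carry comes to rest, even past the last digit.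
  increment-run : ∀ {v k} ds xs → Numeral v xs → suc v < 2 ^ k → length xs ≤ k →
                  suc (length ds + k) < s → Updated increment ds xs (suc v) k
  increment-run {k = zero}  ds xs n (s≤s ()) _ _
  increment-run {k = suc k} ds [] nil _ _ p = record
    { digits = ① ∷ []
    ; value  = one nil
    ; short  = s≤s z≤n
    ; run    = λ i →
        exit (focus-fits ds [] (below z≤n p)) refl ⨾
        onWork-run (focus-fits ds [] (below z≤n p)) (moveWork-left ds ① []) i ⨾
        rewind-run ds (① ∷ []) (<⇒≤ (below (s≤s z≤n) p)) i
    }
  increment-run {k = suc k} ds (␣ ∷ xs) (pad n) _ l p = record
    { digits = ① ∷ xs
    ; value  = one n
    ; short  = l
    ; run    = λ i →
        exit (focus-fits ds (␣ ∷ xs) (below l p)) refl ⨾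
        onWork-run (focus-fits ds (␣ ∷ xs) (below l p)) (moveWork-left ds ① xs) i ⨾
        rewind-run ds (① ∷ xs) (<⇒≤ (below l p)) i
    }
  increment-run {k = suc k} ds (① ∷ xs) (one n) _ l p = record
    { digits = ② ∷ xs
    ; value  = two n
    ; short  = l
    ; run    = λ i →
        exit (focus-fits ds (① ∷ xs) (below l p)) refl ⨾
        onWork-run (focus-fits ds (① ∷ xs) (below l p)) (moveWork-left ds ② xs) i ⨾
        rewind-run ds (② ∷ xs) (<⇒≤ (below l p)) i
    }
  increment-run {k = suc k} ds (② ∷ xs) (two n) v<  (s≤s l) p = record
    { digits = ① ∷ digits
    ; value  = one value
    ; short  = s≤s short
    ; run    = λ i →
        unroll fit refl (onWork-run fit (moveWork-right (passed ds) ① xs) i) (run i)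
    }
    where
    open Updated (increment-run (false ∷ ds) xs n
      (halve-< {suc _} {k} (<-trans (n<1+n _) v<)) l (push p))
    fit = focus-fits ds (② ∷ xs) (below (s≤s l) p)

  -- The bound is on one more than the old value because borrowing past the last digit visits the
  -- cell behind it. For the value 1 it rules out `k = 1`, so that this second cell exists.
  decrement-run : ∀ {v k} ds xs → Numeral (suc v) xs → suc (suc v) < 2 ^ k → length xs ≤ k →
                  suc (length ds + k) < s → Updated decrement ds xs v k
  decrement-run {k = zero} ds xs n (s≤s ()) _ _
  decrement-run {k = suc k} ds (② ∷ xs) (two n) _ l p = record
    { digits = ① ∷ xs
    ; value  = one n
    ; short  = l
    ; run    = λ i →
        exit fit refl ⨾
        branch fit (onWork-run fit (moveWork-left ds ① xs) i) ⨾
        rewind-run ds (① ∷ xs) (<⇒≤ (below l p)) i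
    }
    where
    fit = focus-fits ds (② ∷ xs) (below l p)
  decrement-run {k = suc k} ds (① ∷ xs) (one {suc v} n) v< (s≤s l) p = record
    { digits = ② ∷ digits
    ; value  = two value
    ; short  = s≤s short
    ; run    = λ i →
        unroll fit refl (onWork-run fit (moveWork-right (passed ds) ② xs) i) (run i)
    }
    where
    open Updated (decrement-run (true ∷ ds) xs n (halve-< {suc (suc v)} {k} v<) l (push p))
    fit = focus-fits ds (① ∷ xs) (below (s≤s l) p)
  decrement-run {k = suc zero} ds (① ∷ xs) (one {zero} n) (s≤s (s≤s ())) _ p
  decrement-run {k = suc (suc k)} ds (① ∷ []) (one {zero} n) _ (s≤s l) p = record
    { digits = ␣ ∷ ␣ ∷ []
    ; value  = pad (pad nil)
    ; short  = s≤s (s≤s z≤n)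
    ; run    = λ i →
        unroll fit refl (onWork-run {λ _ → ②} fit refl i) (
        exit fit′ refl ⨾
        branch fit′
          (onWork-run {keep} fit′ refl i ⨾
           onWork-run {λ _ → ␣} fit″ (moveWork-left ds ␣ (␣ ∷ [])) i) ⨾
        rewind-run ds (␣ ∷ ␣ ∷ []) (<⇒≤ (below (s≤s (s≤s z≤n)) p)) i)
    }
    where
    fit  = focus-fits ds (① ∷ []) (below (s≤s z≤n) p)
    fit′ = focus-fits (true ∷ ds) [] (push (below (s≤s z≤n) p))
    fit″ = focus-fits ds (② ∷ ␣ ∷ []) (below (s≤s (s≤s z≤n)) p)
  decrement-run {k = suc (suc k)} ds (① ∷ ␣ ∷ xs) (one {zero} (pad n)) _ (s≤s l) p = record
    { digits = ␣ ∷ ␣ ∷ xs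
    ; value  = pad (pad n)
    ; short  = s≤s l
    ; run    = λ i →
        unroll fit refl (onWork-run {λ _ → ②} fit refl i) (
        exit fit′ refl ⨾
        branch fit′
          (onWork-run {keep} fit′ refl i ⨾
           onWork-run {λ _ → ␣} fit″ (moveWork-left ds ␣ (␣ ∷ xs)) i) ⨾
        rewind-run ds (␣ ∷ ␣ ∷ xs) (<⇒≤ (below (s≤s l) p)) i)
    }
    where
    fit  = focus-fits ds (① ∷ ␣ ∷ xs) (below (s≤s l) p)
    fit′ = focus-fits (true ∷ ds) (␣ ∷ xs) (push (below (s≤s l) p))
    fit″ = focus-fits ds (② ∷ ␣ ∷ xs) (below (s≤s l) p)

-- Programs over the input head and the counter

-- The input up to the head is listed from the head to the left.
infix 4 _∣_
data Head : Set where
  start : List Sym → Head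
  _∣_   : List Sym → List Sym → Head

scanned : Head → InputCell Sym
scanned (start _)     = ⊢
scanned (_ ∣ [])      = ⊣
scanned (_ ∣ (x ∷ _)) = sym x

input : Head → Tape (InputCell Sym)
input (start xs)     = [] ⟨ ⊢ ⟩ (map sym xs ++ [ ⊣ ])
input (l ∣ [])       = (map sym l ++ [ ⊢ ]) ⟨ ⊣ ⟩ []
input (l ∣ (x ∷ xs)) = (map sym l ++ [ ⊢ ]) ⟨ sym x ⟩ (map sym xs ++ [ ⊣ ])

current-input : ∀ h → current (input h) ≡ scanned h
current-input (start _)     = refl
current-input (_ ∣ [])      = refl
current-input (_ ∣ (_ ∷ _)) = refl

move : Move → Head → Head
move left  (start xs)     = start xs
move left  ([] ∣ xs)      = start xs
move left  (x ∷ l ∣ xs)   = l ∣ x ∷ xs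
move stay  h              = h
move right (start xs)     = [] ∣ xs
move right (l ∣ [])       = l ∣ []
move right (l ∣ (x ∷ xs)) = x ∷ l ∣ xs

moveInput-input : ∀ μ h → moveInput μ (input h) ≡ input (move μ h)
moveInput-input left  (start xs)         = refl
moveInput-input left  ([] ∣ [])          = refl
moveInput-input left  ([] ∣ (_ ∷ _))     = refl
moveInput-input left  (_ ∷ _ ∣ [])       = refl
moveInput-input left  (_ ∷ _ ∣ (_ ∷ _))  = refl
moveInput-input stay  h                  = refl
moveInput-input right (start [])         = refl
moveInput-input right (start (_ ∷ _))    = refl
moveInput-input right (_ ∣ [])           = refl
moveInput-input right (_ ∣ (_ ∷ []))     = refl
moveInput-input right (_ ∣ (_ ∷ _ ∷ _))  = refl

data Condition : Set where
  reading  : (InputCell Sym → Bool) → Condition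
  positive : Condition

toTest : Condition → Test
toTest (reading b) c _ = b c
toTest positive    _ x = nonblank x

holds : Condition → Head → ℕ → Bool
holds (reading b) h _ = b (scanned h)
holds positive    _ v = 0 <ᵇ v

act : (InputCell Sym → Maybe Sym) → Move → Program
act e μ = basic (λ c x → instruction (e c) μ x stay)

go : Move → Program
go = act (λ _ → nothing)

print : List Sym → Program
print []       = go stay
print (x ∷ xs) = act (λ _ → just x) stay ⨾ print xs

while : Condition → Program → Program
while b = loop (toTest b)

when : Condition → Program → Program → Program
when b = branch (toTest b)

module Counting {s k c : ℕ} (k<s : suc k < s) (c<2ᵏ : suc c < 2 ^ k) where

  record Counter (v : ℕ) (t : Tape Digit) : Set where
    constructor counter
    field
      {digits}  : List Digit
      tape      : t ≡ focus [ ␣ ] digits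
      value     : Numeral v digits
      short     : length digits ≤ k
      bounded   : v ≤ c

  counter-fits : ∀ {v t} → Counter v t → cells t ≤ s
  counter-fits (counter {digits} refl _ short _) = focus-fits [] digits (≤-<-trans (s≤s short) k<s)

  sign : ∀ {v t} → Counter v t → nonblank (current t) ≡ (0 <ᵇ v)
  sign (counter refl nil     _ _) = refl
  sign (counter refl (pad _) _ _) = refl
  sign (counter refl (one _) _ _) = refl
  sign (counter refl (two _) _ _) = refl

  infix 4 _∶_,_⇒_,_!_
  -- Padding gives a number many tapes, and an update may return any of them. A specification thus
  -- accepts every tape for `v` and promises some tape for `v′`, which hides the tape from all later
  -- arguments.
  record _∶_,_⇒_,_!_ (p : Program) (h : Head) (v : ℕ) (h′ : Head) (v′ : ℕ) (w : List Sym) : Set where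
    constructor runs
    field
      run : ∀ {t} → Counter v t →
            ∃[ t′ ] Counter v′ t′ × _⊢_⇒_!_ s p (input h , t) (input h′ , t′) w

  open _∶_,_⇒_,_!_ public

  private variable
    p q : Program
    f g h : Head
    u v x : ℕ
    w y z : List Sym

  output-≡ : p ∶ g , u ⇒ h , v ! w → w ≡ y → p ∶ g , u ⇒ h , v ! y
  output-≡ r refl = r

  land-≡ : p ∶ f , u ⇒ g , v ! w → g ≡ h → p ∶ f , u ⇒ h , v ! w
  land-≡ r refl = r

  infixr 5 _▹_
  _▹_ : p ∶ f , u ⇒ g , v ! w → q ∶ g , v ⇒ h , x ! y → p ⨾ q ∶ f , u ⇒ h , x ! w ++ y
  run (r ▹ r′) t with run r t
  ... | t′ , c′ , e with run r′ c′
  ... | t″ , c″ , e′ = t″ , c″ , (e ⨾ e′)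

  test : ∀ {t} b h → Counter v t → seen (toTest b) (input h , t) ≡ holds b h v
  test (reading b) h _ = cong b (current-input h)
  test positive    h t = sign t

  while-exit : ∀ b → holds b h v ≡ false → while b p ∶ h , v ⇒ h , v ! []
  run (while-exit {h} b eq) t = _ , t , exit (counter-fits t) (trans (test b h t) eq)

  while-again : ∀ b → holds b f u ≡ true → p ∶ f , u ⇒ g , v ! w →
                while b p ∶ g , v ⇒ h , x ! y → while b p ∶ f , u ⇒ h , x ! w ++ y
  run (while-again {f} b eq r r′) t with run r t
  ... | t′ , c′ , e with run r′ c′
  ... | t″ , c″ , e′ = t″ , c″ , again (counter-fits t) (trans (test b f t) eq) e e′

  when-run : ∀ b → (if holds b g u then p else q) ∶ g , u ⇒ h , v ! w → when b p q ∶ g , u ⇒ h , v ! w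
  run (when-run {g} {u} {p} {q} b r) t with run r t
  ... | t′ , c′ , e = t′ , c′ , branch (counter-fits t)
    (subst (λ z → _⊢_⇒_!_ s (if z then p else q) _ _ _) (≡-sym (test b g t)) e)

  act-run : ∀ e μ → act e μ ∶ h , v ⇒ move μ h , v ! emission (e (scanned h))
  run (act-run {h} e μ) {l ⟨ x ⟩ r} t
    rewrite ≡-sym (moveInput-input μ h) | ≡-sym (current-input h) =
    _ , t , basic {a = λ c x → instruction (e c) μ x stay} (counter-fits t)

  go-run : ∀ μ → go μ ∶ h , v ⇒ move μ h , v ! []
  go-run = act-run (λ _ → nothing)

  print-run : ∀ w → print w ∶ h , v ⇒ h , v ! w
  print-run []      = go-run stay
  print-run (x ∷ w) = act-run (λ _ → just x) stay ▹ print-run w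

  increment-runs : v < c → increment ∶ h , v ⇒ h , suc v ! []
  run (increment-runs v<c) (counter {digits} refl n l _) =
    _ , counter refl value short v<c , Updated.run updated _
    where
    updated = increment-run [] digits n (≤-<-trans v<c (<-trans (n<1+n c) c<2ᵏ)) l k<s
    open Updated updated

  decrement-runs : decrement ∶ h , suc v ⇒ h , v ! []
  run decrement-runs (counter {digits} refl n l v<c) =
    _ , counter refl value short (<⇒≤ v<c) , Updated.run updated _
    where
    updated = decrement-run [] digits n (≤-<-trans (s≤s v<c) c<2ᵏ) l k<s
    open Updated updated

-- The program computing the reduction

tab : ∀ {A : Set} {n} → (Fin n → List A) → List A
tab {n = zero}  f = []
tab {n = suc n} f = f zero ++ tab (f ∘ suc)

concatMap-tabulate : ∀ {A B : Set} {n} (f : B → List A) (g : Fin n → B) →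
                     concatMap f (tabulate g) ≡ tab (f ∘ g)
concatMap-tabulate {n = zero}  f g = refl
concatMap-tabulate {n = suc n} f g = cong (f (g zero) ++_) (concatMap-tabulate f (g ∘ suc))

tab-cong : ∀ {A : Set} {n} {f g : Fin n → List A} → (∀ i → f i ≡ g i) → tab f ≡ tab g
tab-cong {n = zero}  eq = refl
tab-cong {n = suc n} eq = cong₂ _++_ (eq zero) (tab-cong (eq ∘ suc))

times : ∀ {A : Set} → ℕ → List A → List A
times n w = concat (replicate n w)

tab-const : ∀ {A : Set} n (w : List A) → tab {n = n} (λ _ → w) ≡ times n w
tab-const zero    w = refl
tab-const (suc n) w = cong (w ++_) (tab-const n w)

rest : ∀ {n} → Fin n → ℕ
rest {n} i = n ∸ suc (toℕ i)

tab-diagonal : ∀ {A : Set} {n} (i : Fin n) (d o : List A) →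
               tab (λ j → if does (i ≟ j) then d else o) ≡ times (toℕ i) o ++ d ++ times (rest i) o
tab-diagonal {n = suc n} zero    d o = cong (d ++_) (tab-const n o)
tab-diagonal             (suc i) d o =
  trans (cong (o ++_) (tab-diagonal i d o)) (≡-sym (++-assoc o (times (toℕ i) o) _))

toℕ+rest : ∀ {n} (i : Fin n) → toℕ i + suc (rest i) ≡ n
toℕ+rest i = trans (+-suc (toℕ i) (rest i)) (m+[n∸m]≡n (toℕ<n i))

ones : ℕ → List Sym
ones n = replicate n 𝟏

-- A 𝟏 that the head passes moves from one side of `_∣_` to the other; this restores the shape
-- `ones n ++ _` afterwards.
ones-shift : ∀ n xs → ones n ++ 𝟏 ∷ xs ≡ 𝟏 ∷ ones n ++ xs
ones-shift zero    xs = refl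
ones-shift (suc n) xs = cong (𝟏 ∷_) (ones-shift n xs)

isOne isSep isStart isEnd : InputCell Sym → Bool
isOne (sym 𝟏) = true
isOne _       = false
isSep (sym sep) = true
isSep _         = false
isStart ⊢ = true
isStart _ = false
isEnd ⊣ = true
isEnd _ = false

NoSep : List Sym → Set
NoSep = All (λ x → isSep (sym x) ≡ false)

seps : List Sym → ℕ
seps []       = 0
seps (x ∷ xs) = if isSep (sym x) then suc (seps xs) else seps xs

-- `home` trades the position of the head inside a block of ones for a counter value, and `away`
-- trades it back.
home away toSep skip toStart : Program
home = go left ⨾ while (reading isOne) (increment ⨾ go left) ⨾ go right
toSep = while (reading (not ∘ isSep)) (go right)
skip = toSep ⨾ go right
toStart = go left ⨾ while (reading (not ∘ isStart)) (go left)

spend earn runOnes : List Sym → Program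
spend w   = while positive (print w ⨾ go right ⨾ decrement)
earn w    = while (reading isOne) (print w ⨾ increment ⨾ go right)
runOnes w = while (reading isOne) (print w ⨾ go right)
away = spend []

-- Entered with the counter at zero and the head on a cell of a block of
-- ones; w is printed for each other cell, d for the cell of the head.
sweep : List Sym → List Sym → Program
sweep w d =
  home ⨾ spend w ⨾ print d ⨾ go right ⨾ earn w ⨾
  while positive (go left ⨾ decrement) ⨾ go left

-- Meant to start on the first cell after the separator that ends the first block of ones: the first
-- move to the left reaches that separator, the second enters the block, or meets the left marker if
-- the block is empty.
across : List Sym → Program
across w = go left ⨾ go left ⨾ while (reading isOne) (go left) ⨾ go right ⨾ runOnes w ⨾ go right

-- The separators passed on the way back are the ones of the rows above
-- and the two of the header.
scanRow : Program → Program
scanRow p =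
  home ⨾ skip ⨾ skip ⨾ while positive (skip ⨾ decrement) ⨾
  while (reading (not ∘ isSep)) p ⨾
  go left ⨾ while (reading (not ∘ isStart)) (when (reading isSep) increment (go stay) ⨾ go left) ⨾
  decrement ⨾ decrement ⨾ go right ⨾ away

forEach : Program → Program
forEach p = while (reading isOne) (p ⨾ go right)

letter : InputCell Sym → Maybe Sym
letter (sym x) = just x
letter _       = nothing

-- The encoding of `k` is located from the right, as what follows the last separator. This works
-- from any position of the head and needs no counter.
copyTail : Program
copyTail =
  while (reading (not ∘ isEnd)) (go right) ⨾
  go left ⨾ while (reading (not ∘ isSep)) (go left) ⨾ go right ⨾
  while (reading (not ∘ isEnd)) (act letter right)

entry-of : Bool → Cost → List Sym
entry-of b q = encodeBool b ∷ encodeCost q ++ [ sep ]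

forbidden free paid fixed : List Sym
forbidden = entry-of false ⊤⁺
free      = entry-of false (fin 0ℚ)
paid      = entry-of true (fin (fromℤ (ℤ.+ 1)))
fixed     = entry-of true ⊤⁺

readBlue readRed : Program
readBlue =
  when (reading isOne)
    (go right ⨾ when (reading isOne) (print forbidden) (print free))
    (go right ⨾ print forbidden) ⨾
  go right
readRed = go right ⨾ when (reading isOne) (print free) (print forbidden) ⨾ go right

firstRow secondRow thirdRow header build bounds main : Program
-- A constant block is printed as a diagonal whose two kinds of entries agree, because `sweep`
-- already restores both the head and the counter.
firstRow  = sweep forbidden paid ⨾ sweep forbidden forbidden ⨾ scanRow readBlue ⨾ print [ sep ]
secondRow = sweep forbidden free ⨾ sweep forbidden fixed ⨾ scanRow readRed ⨾ print [ sep ]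
thirdRow  = (home ⨾ across forbidden ⨾ across free ⨾ away) ⨾ sweep forbidden fixed ⨾ print [ sep ]
header = runOnes (𝟏 ∷ 𝟏 ∷ []) ⨾ go right ⨾ runOnes [ 𝟏 ] ⨾ print [ sep ] ⨾ toStart ⨾ go right
build =
  forEach firstRow ⨾ toStart ⨾ go right ⨾ forEach secondRow ⨾ go right ⨾ forEach thirdRow
bounds = copyTail ⨾ print [ sep ] ⨾ copyTail ⨾ print (slash ∷ encodeℕ 1)
-- Moving right at once leaves a stored blank on the left of the work head, the marker that `rewind`
-- relies on.
main = onWork keep right ⨾ go right ⨾ header ⨾ build ⨾ bounds

-- Separators in the input word

seps-ʳ++ : ∀ xs ys → seps (xs ʳ++ ys) ≡ seps xs + seps ys
seps-ʳ++ []       ys = refl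
seps-ʳ++ (x ∷ xs) ys rewrite seps-ʳ++ xs (x ∷ ys) with isSep (sym x)
... | true  = +-suc (seps xs) (seps ys)
... | false = refl

seps-NoSep : ∀ {xs} → NoSep xs → seps xs ≡ 0
seps-NoSep []       = refl
seps-NoSep (p ∷ ps) rewrite p = seps-NoSep ps

seps-++ : ∀ xs ys → seps (xs ++ ys) ≡ seps xs + seps ys
seps-++ []       ys = refl
seps-++ (x ∷ xs) ys with isSep (sym x)
... | true  = cong suc (seps-++ xs ys)
... | false = seps-++ xs ys

NoSep-ones : ∀ n → NoSep (ones n)
NoSep-ones zero    = []
NoSep-ones (suc n) = refl ∷ NoSep-ones n

NoSep-ʳ++ : ∀ {xs ys} → NoSep xs → NoSep ys → NoSep (xs ʳ++ ys)
NoSep-ʳ++ []       qs = qs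
NoSep-ʳ++ (p ∷ ps) qs = NoSep-ʳ++ ps (p ∷ qs)

isSep-encodeBool : ∀ a → isSep (sym (encodeBool a)) ≡ false
isSep-encodeBool false = refl
isSep-encodeBool true  = refl

pairs : ∀ {n} → (Fin n → Bool) → (Fin n → Bool) → List Sym
pairs e r = tab (λ j → encodeBool (e j) ∷ encodeBool (r j) ∷ [])

NoSep-pairs : ∀ {n} (e r : Fin n → Bool) → NoSep (pairs e r)
NoSep-pairs {zero}  e r = []
NoSep-pairs {suc n} e r =
  isSep-encodeBool (e zero) ∷ isSep-encodeBool (r zero) ∷ NoSep-pairs (e ∘ suc) (r ∘ suc)

ones-split : ∀ {n} (i : Fin n) xs → ones (toℕ i) ++ 𝟏 ∷ ones (rest i) ++ xs ≡ ones n ++ xs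
ones-split zero    xs = refl
ones-split (suc i) xs = cong (𝟏 ∷_) (ones-split i xs)

table : ∀ {m} → (Fin m → List Sym) → List Sym
table rows = tab (λ i → rows i ++ [ sep ])

onBlue onRed : Bool → Bool → List Sym
onBlue e r = if e ∧ not r then free else forbidden
onRed  e r = if r then free else forbidden

-- Runs of the subprograms on an encoded graph

module _ {s k c : ℕ} (k<s : suc k < s) (c<2ᵏ : suc c < 2 ^ k) where
  open Counting k<s c<2ᵏ

  data Boundary : List Sym → Set where
    start : Boundary []
    sep   : ∀ {l} → Boundary (sep ∷ l)

  boundary-stops : ∀ {l} xs → Boundary l → isOne (scanned (move left (l ∣ xs))) ≡ false
  boundary-stops xs start = refl
  boundary-stops xs sep   = refl

  right∘left : ∀ l xs → move right (move left (l ∣ xs)) ≡ (l ∣ xs)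
  right∘left []      xs = refl
  right∘left (_ ∷ _) xs = refl

  go-run′ : ∀ {h h′ v} μ → move μ h ≡ h′ → go μ ∶ h , v ⇒ h′ , v ! []
  go-run′ μ refl = go-run μ

  -- Writing the head as `move left` of a position treats the two possible boundaries alike: the
  -- left marker of the input and a separator.
  home-loop : ∀ {l v} i xs → Boundary l → v + i ≤ c →
              while (reading isOne) (increment ⨾ go left) ∶
              move left (ones i ++ l ∣ xs) , v ⇒ move left (l ∣ ones i ++ xs) , v + i ! []
  home-loop {l} {v} zero xs b p rewrite +-identityʳ v = while-exit (reading isOne) (boundary-stops xs b)
  home-loop {l} {v} (suc i) xs b p rewrite +-suc v i =
    while-again (reading isOne) refl (increment-runs (≤-<-trans (m≤m+n v i) p) ▹ go-run left)
      (land-≡ (home-loop i (𝟏 ∷ xs) b p) (cong (λ z → move left (l ∣ z)) (ones-shift i xs)))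

  home-run : ∀ {l} i xs → Boundary l → i ≤ c →
             home ∶ ones i ++ l ∣ xs , 0 ⇒ l ∣ ones i ++ xs , i ! []
  home-run {l} i xs b p = go-run left ▹ home-loop i xs b p ▹ go-run′ right (right∘left l _)

  spend-run : ∀ {l} i xs w → spend w ∶ l ∣ ones i ++ xs , i ⇒ ones i ++ l ∣ xs , 0 ! times i w
  spend-run zero    xs w = while-exit positive refl
  spend-run {l} (suc i) xs w =
    output-≡ (while-again positive refl (print-run w ▹ go-run right ▹ decrement-runs)
      (land-≡ (spend-run i xs w) (cong (_∣ xs) (ones-shift i l))))
      (cong (_++ times i w) (++-identityʳ w))

  times-[] : ∀ {A : Set} n → times {A} n [] ≡ []
  times-[] zero    = refl
  times-[] (suc n) = times-[] n

  away-run : ∀ {l} i xs → away ∶ l ∣ ones i ++ xs , i ⇒ ones i ++ l ∣ xs , 0 ! []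
  away-run i xs = output-≡ (spend-run i xs []) (times-[] i)

  earn-run : ∀ {l v} q xs w → v + q ≤ c →
             earn w ∶ l ∣ ones q ++ sep ∷ xs , v ⇒ ones q ++ l ∣ sep ∷ xs , v + q ! times q w
  earn-run {l} {v} zero    xs w p rewrite +-identityʳ v = while-exit (reading isOne) refl
  earn-run {l} {v} (suc q) xs w p rewrite +-suc v q =
    output-≡ (while-again (reading isOne) refl
      (print-run w ▹ increment-runs (≤-<-trans (m≤m+n v q) p) ▹ go-run right)
      (land-≡ (earn-run q xs w p) (cong (_∣ sep ∷ xs) (ones-shift q l))))
      (cong (_++ times q w) (++-identityʳ w))

  runOnes-run : ∀ {l v} q xs w →
                runOnes w ∶ l ∣ ones q ++ sep ∷ xs , v ⇒ ones q ++ l ∣ sep ∷ xs , v ! times q w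
  runOnes-run zero    xs w = while-exit (reading isOne) refl
  runOnes-run {l} (suc q) xs w =
    output-≡ (while-again (reading isOne) refl (print-run w ▹ go-run right)
      (land-≡ (runOnes-run q xs w) (cong (_∣ sep ∷ xs) (ones-shift q l))))
      (cong (_++ times q w) (++-identityʳ w))

  retreat-run : ∀ {l} q xs → while positive (go left ⨾ decrement) ∶
                ones q ++ l ∣ xs , q ⇒ l ∣ ones q ++ xs , 0 ! []
  retreat-run zero    xs = while-exit positive refl
  retreat-run {l} (suc q) xs =
    while-again positive refl (go-run left ▹ decrement-runs)
      (land-≡ (retreat-run q (𝟏 ∷ xs)) (cong (l ∣_) (ones-shift q xs)))

  sweep-run : ∀ {l} i q xs w d → Boundary l → i + suc q ≤ c →
              sweep w d ∶
              ones i ++ l ∣ 𝟏 ∷ ones q ++ sep ∷ xs , 0 ⇒ ones i ++ l ∣ 𝟏 ∷ ones q ++ sep ∷ xs , 0 !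
              times i w ++ d ++ times q w
  sweep-run i q xs w d b p =
    output-≡
      (home-run i _ b (≤-trans (m≤m+n i _) p) ▹ spend-run i _ w ▹ print-run d ▹ go-run right ▹
       earn-run q xs w (≤-trans (≤-trans (n≤1+n q) (m≤n+m (suc q) i)) p) ▹ retreat-run q _ ▹ go-run left)
      (cong (λ z → times i w ++ d ++ z) (++-identityʳ (times q w)))

  left-run : ∀ {l v} i xs → Boundary l →
             while (reading isOne) (go left) ∶
             move left (ones i ++ l ∣ xs) , v ⇒ move left (l ∣ ones i ++ xs) , v ! []
  left-run zero    xs b = while-exit (reading isOne) (boundary-stops xs b)
  left-run {l} (suc i) xs b = while-again (reading isOne) refl (go-run left)
    (land-≡ (left-run i (𝟏 ∷ xs) b) (cong (λ z → move left (l ∣ z)) (ones-shift i xs)))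

  across-run : ∀ {v} m xs w →
               across w ∶ sep ∷ ones m ++ [] ∣ xs , v ⇒ sep ∷ ones m ++ [] ∣ xs , v ! times m w
  across-run m xs w =
    output-≡
      (go-run left ▹ go-run left ▹ left-run m (sep ∷ xs) start ▹
       go-run right ▹ runOnes-run m xs w ▹ go-run right)
      (++-identityʳ (times m w))

  toSep-run : ∀ {l v ys} xs → NoSep ys → toSep ∶ l ∣ ys ++ sep ∷ xs , v ⇒ ys ʳ++ l ∣ sep ∷ xs , v ! []
  toSep-run xs []       = while-exit (reading (not ∘ isSep)) refl
  toSep-run xs (p ∷ ps) = while-again (reading (not ∘ isSep)) (cong not p) (go-run right) (toSep-run xs ps)

  skip-run : ∀ {l v ys} xs → NoSep ys → skip ∶ l ∣ ys ++ sep ∷ xs , v ⇒ sep ∷ (ys ʳ++ l) ∣ xs , v ! []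
  skip-run xs ps = toSep-run xs ps ▹ go-run right

  back-run : ∀ {v} l xs → v + seps l ≤ c →
             while (reading (not ∘ isStart)) (when (reading isSep) increment (go stay) ⨾ go left) ∶
             move left (l ∣ xs) , v ⇒ start (l ʳ++ xs) , v + seps l ! []
  back-run {v} [] xs p rewrite +-identityʳ v = while-exit (reading (not ∘ isStart)) refl
  back-run {v} (x ∷ l) xs p with isSep (sym x) in eq
  ... | true rewrite +-suc v (seps l) =
    while-again (reading (not ∘ isStart)) refl
      (when-run (reading isSep)
        (subst (λ z → (if z then increment else go stay) ∶ l ∣ x ∷ xs , v ⇒ l ∣ x ∷ xs , suc v ! [])
          (≡-sym eq) (increment-runs (≤-<-trans (m≤m+n v _) p))) ▹
       go-run left)
      (back-run l (x ∷ xs) p)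
  ... | false =
    while-again (reading (not ∘ isStart)) refl
      (when-run (reading isSep)
        (subst (λ z → (if z then increment else go stay) ∶ l ∣ x ∷ xs , v ⇒ l ∣ x ∷ xs , v ! [])
          (≡-sym eq) (go-run stay)) ▹
       go-run left)
      (back-run l (x ∷ xs) p)

  toStart-run : ∀ {v} l xs → toStart ∶ l ∣ xs , v ⇒ start (l ʳ++ xs) , v ! []
  toStart-run l xs = go-run left ▹ lefts l xs
    where
    lefts : ∀ {v} l xs → while (reading (not ∘ isStart)) (go left) ∶
            move left (l ∣ xs) , v ⇒ start (l ʳ++ xs) , v ! []
    lefts []      xs = while-exit (reading (not ∘ isStart)) refl
    lefts (x ∷ l) xs = while-again (reading (not ∘ isStart)) refl (go-run left) (lefts l (x ∷ xs))

  forEach-run : ∀ {p l xs} n (w : Fin n → List Sym) →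
    (∀ i → p ∶ ones (toℕ i) ++ l ∣ 𝟏 ∷ ones (rest i) ++ sep ∷ xs , 0
             ⇒ ones (toℕ i) ++ l ∣ 𝟏 ∷ ones (rest i) ++ sep ∷ xs , 0 ! w i) →
    forEach p ∶ l ∣ ones n ++ sep ∷ xs , 0 ⇒ ones n ++ l ∣ sep ∷ xs , 0 ! tab w
  forEach-run zero    w r = while-exit (reading isOne) refl
  forEach-run {p} {l} {xs} (suc n) w r =
    output-≡ (while-again (reading isOne) refl (r zero ▹ go-run right)
      (land-≡
        (forEach-run n (w ∘ suc) λ i →
          -- The 𝟏 just visited joins the left context, so index `suc i` over `l` is index `i` over
          -- `𝟏 ∷ l`.
          subst (λ z → p ∶ z ∣ cell i , 0 ⇒ z ∣ cell i , 0 ! w (suc i))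
            (≡-sym (ones-shift (toℕ i) l)) (r (suc i)))
        (cong (_∣ sep ∷ xs) (ones-shift n l))))
      (cong (_++ tab (w ∘ suc)) (++-identityʳ (w zero)))
    where
    cell : Fin n → List Sym
    cell i = 𝟏 ∷ ones (rest i) ++ sep ∷ xs

  record Reads (p : Program) (out : Bool → Bool → List Sym) : Set where
    field
      reads : ∀ {l xs v} a b → p ∶ l ∣ encodeBool a ∷ encodeBool b ∷ xs , v ⇒
                                   encodeBool b ∷ encodeBool a ∷ l ∣ xs , v ! out a b
  open Reads

  readBlue-reads : Reads readBlue onBlue
  reads readBlue-reads {l} {xs} {v} a b =
    output-≡ (when-run (reading isOne) (choose a b) ▹ go-run right) (++-identityʳ (onBlue a b))
    where
    choose : ∀ a b → (if isOne (sym (encodeBool a))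
                      then (go right ⨾ when (reading isOne) (print forbidden) (print free))
                      else (go right ⨾ print forbidden)) ∶
             l ∣ encodeBool a ∷ encodeBool b ∷ xs , v ⇒ encodeBool a ∷ l ∣ encodeBool b ∷ xs , v ! onBlue a b
    choose true  true  = go-run right ▹ when-run (reading isOne) (print-run forbidden)
    choose true  false = go-run right ▹ when-run (reading isOne) (print-run free)
    choose false b     = go-run right ▹ print-run forbidden

  readRed-reads : Reads readRed onRed
  reads readRed-reads {l} {xs} {v} a b =
    output-≡ (go-run right ▹ when-run (reading isOne) (choose b) ▹ go-run right)
      (++-identityʳ (onRed a b))
    where
    choose : ∀ b → (if isOne (sym (encodeBool b)) then print free else print forbidden) ∶
             encodeBool a ∷ l ∣ encodeBool b ∷ xs , v ⇒ encodeBool a ∷ l ∣ encodeBool b ∷ xs , v ! onRed a b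
    choose true  = print-run free
    choose false = print-run forbidden

  scan-run : ∀ {p out l v n} → Reads p out → (e r : Fin n → Bool) → ∀ xs →
             while (reading (not ∘ isSep)) p ∶
             l ∣ pairs e r ++ sep ∷ xs , v ⇒ pairs e r ʳ++ l ∣ sep ∷ xs , v !
             tab (λ j → out (e j) (r j))
  scan-run {n = zero}  P e r xs = while-exit (reading (not ∘ isSep)) refl
  scan-run {n = suc n} P e r xs =
    while-again (reading (not ∘ isSep)) (cong not (isSep-encodeBool (e zero)))
      (reads P (e zero) (r zero)) (scan-run P (e ∘ suc) (r ∘ suc) xs)

  -- One cut of the table serves both directions of the trip. On the way out, `skipped` spends the
  -- counter on the rows in `before`; `counted` says that their separators still hold the index, so
  -- that it can be recovered on the way back.
  record RowSplit {m} (rows : Fin m → List Sym) (K : List Sym) (i : Fin m) : Set where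
    field
      before after : List Sym
      split        : before ++ rows i ++ sep ∷ after ≡ table rows ++ K
      counted      : seps before ≡ toℕ i
      skipped      : ∀ {l} → while positive (skip ⨾ decrement) ∶
                     l ∣ table rows ++ K , toℕ i ⇒ before ʳ++ l ∣ rows i ++ sep ∷ after , 0 ! []

  rowSplit : ∀ {m} (rows : Fin m → List Sym) K i → (∀ i → NoSep (rows i)) → RowSplit rows K i
  rowSplit {suc m} rows K zero ns = record
    { before  = []
    ; after   = table (rows ∘ suc) ++ K
    ; split   = ≡-sym eq
    ; counted = refl
    ; skipped = λ {l} → land-≡ (while-exit positive refl) (cong (l ∣_) eq)
    }
    where
    eq : table rows ++ K ≡ rows zero ++ sep ∷ table (rows ∘ suc) ++ K
    eq = trans (cong (_++ K) (++-assoc (rows zero) [ sep ] _)) (++-assoc (rows zero) _ K)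
  rowSplit {suc m} rows K (suc i) ns = record
    { before  = rows zero ++ sep ∷ before
    ; after   = after
    ; split   = trans (++-assoc (rows zero) (sep ∷ before) _)
                  (trans (cong (λ z → rows zero ++ sep ∷ z) split) (≡-sym eq))
    ; counted = trans (seps-++ (rows zero) (sep ∷ before))
                  (cong₂ _+_ (seps-NoSep (ns zero)) (cong suc counted))
    ; skipped = λ {l} → subst₂ (λ y z → while positive (skip ⨾ decrement) ∶
        l ∣ y , suc (toℕ i) ⇒ z ∣ rows (suc i) ++ sep ∷ after , 0 ! [])
        (≡-sym eq) (≡-sym (++-ʳ++ (rows zero)))
        (while-again positive refl (skip-run _ (ns zero) ▹ decrement-runs) skipped)
    }
    where
    open RowSplit (rowSplit (rows ∘ suc) K i (ns ∘ suc))
    eq : table rows ++ K ≡ rows zero ++ sep ∷ table (rows ∘ suc) ++ K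
    eq = trans (cong (_++ K) (++-assoc (rows zero) [ sep ] _)) (++-assoc (rows zero) _ K)

  sweep-diagonal : ∀ {l m} (i : Fin m) xs w d → Boundary l → m ≤ c →
    sweep w d ∶ ones (toℕ i) ++ l ∣ 𝟏 ∷ ones (rest i) ++ sep ∷ xs , 0
              ⇒ ones (toℕ i) ++ l ∣ 𝟏 ∷ ones (rest i) ++ sep ∷ xs , 0 !
              tab (λ j → if does (i ≟ j) then d else w)
  sweep-diagonal i xs w d b m≤c =
    output-≡ (sweep-run (toℕ i) (rest i) xs w d b (subst (_≤ c) (≡-sym (toℕ+rest i)) m≤c))
      (≡-sym (tab-diagonal i d w))

  module _ {m n : ℕ} (E R : Fin m → Fin n → Bool) (K : List Sym)
           (K-NoSep : NoSep K) (m<c : 2 + m ≤ c) (n≤c : n ≤ c) where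

    rows : Fin m → List Sym
    rows i = pairs (E i) (R i)

    rows-NoSep : ∀ i → NoSep (rows i)
    rows-NoSep i = NoSep-pairs (E i) (R i)

    body word : List Sym
    body = ones n ++ sep ∷ table rows ++ K
    word = ones m ++ sep ∷ body

    m≤c : m ≤ c
    m≤c = ≤-trans (m≤n+m m 2) m<c

    scanRow-run : ∀ {p out} → Reads p out → ∀ i →
      scanRow p ∶ ones (toℕ i) ++ [] ∣ 𝟏 ∷ ones (rest i) ++ sep ∷ body , 0
                ⇒ ones (toℕ i) ++ [] ∣ 𝟏 ∷ ones (rest i) ++ sep ∷ body , 0 !
                tab (λ j → out (E i j) (R i j))
    scanRow-run {p} {out} P i =
      output-≡
        (land-≡ (home-run (toℕ i) _ start (≤-trans (<⇒≤ (toℕ<n i)) m≤c)) (cong ([] ∣_) (ones-split i _)) ▹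
         skip-run body (NoSep-ones m) ▹
         skip-run (table rows ++ K) (NoSep-ones n) ▹
         skipped ▹
         scan-run P (E i) (R i) after ▹
         go-run left ▹
         subst₂ (λ xs v → countBack ∶ move left (l ∣ sep ∷ after) , 0 ⇒ start xs , v ! [])
           restored counted′
           -- On the way back the counter climbs to `2 + toℕ i`, the two separators of the header
           -- included; this is the origin of the summand 2 in the bound on the counter.
           (back-run l (sep ∷ after) (subst (_≤ c) (≡-sym counted′) (≤-trans (s≤s (s≤s (<⇒≤ (toℕ<n i)))) m<c))) ▹
         decrement-runs ▹ decrement-runs ▹
         land-≡ (go-run right) (cong ([] ∣_) (≡-sym (ones-split i _))) ▹
         away-run (toℕ i) _)
        (++-identityʳ _)
      where
      open RowSplit (rowSplit rows K i rows-NoSep)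
      countBack : Program
      countBack = while (reading (not ∘ isStart)) (when (reading isSep) increment (go stay) ⨾ go left)
      l₀ l : List Sym
      l₀ = sep ∷ (ones n ʳ++ sep ∷ (ones m ʳ++ []))
      l  = rows i ʳ++ before ʳ++ l₀
      counted′ : seps l ≡ suc (suc (toℕ i))
      counted′ = begin
        seps l                                          ≡⟨ seps-ʳ++ (rows i) _ ⟩
        seps (rows i) + seps (before ʳ++ l₀)            ≡⟨ cong₂ _+_ (seps-NoSep (rows-NoSep i)) (seps-ʳ++ before l₀) ⟩
        seps before + seps l₀                           ≡⟨ cong₂ _+_ counted (cong suc (seps-ʳ++ (ones n) _)) ⟩
        toℕ i + suc (seps (ones n) + suc (seps (ones m ʳ++ [])))
          ≡⟨ cong (λ z → toℕ i + suc z) (cong₂ _+_ (seps-NoSep (NoSep-ones n))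
               (cong suc (trans (seps-ʳ++ (ones m) []) (cong (_+ 0) (seps-NoSep (NoSep-ones m)))))) ⟩
        toℕ i + 2                                       ≡⟨ +-comm (toℕ i) 2 ⟩
        suc (suc (toℕ i))                               ∎
        where open ≡-Reasoning
      restored : l ʳ++ sep ∷ after ≡ word
      restored = begin
        l ʳ++ sep ∷ after                               ≡⟨ ʳ++-ʳ++ (rows i) ⟩
        (before ʳ++ l₀) ʳ++ rows i ++ sep ∷ after       ≡⟨ ʳ++-ʳ++ before ⟩
        l₀ ʳ++ before ++ rows i ++ sep ∷ after          ≡⟨ cong (l₀ ʳ++_) split ⟩
        l₀ ʳ++ table rows ++ K                          ≡⟨ ʳ++-ʳ++ (ones n) ⟩
        (sep ∷ (ones m ʳ++ [])) ʳ++ body                ≡⟨ ʳ++-ʳ++ (ones m) ⟩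
        word                                            ∎
        where open ≡-Reasoning

    diagonal : ∀ {n} → Fin n → List Sym → List Sym
    diagonal i d = tab (λ j → if does (i ≟ j) then d else forbidden)

    firstOut secondOut : Fin m → List Sym
    firstOut i =
      diagonal i paid ++ diagonal i forbidden ++ tab (λ j → onBlue (E i j) (R i j)) ++ [ sep ]
    secondOut i =
      diagonal i free ++ diagonal i fixed ++ tab (λ j → onRed (E i j) (R i j)) ++ [ sep ]

    thirdOut : Fin n → List Sym
    thirdOut j = (times m forbidden ++ times m free) ++ diagonal j fixed ++ [ sep ]

    firstRow-run : ∀ i → firstRow ∶
      ones (toℕ i) ++ [] ∣ 𝟏 ∷ ones (rest i) ++ sep ∷ body , 0 ⇒
      ones (toℕ i) ++ [] ∣ 𝟏 ∷ ones (rest i) ++ sep ∷ body , 0 ! firstOut i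
    firstRow-run i =
      sweep-diagonal i body _ _ start m≤c ▹ sweep-diagonal i body _ _ start m≤c ▹
      scanRow-run readBlue-reads i ▹ print-run [ sep ]

    secondRow-run : ∀ i → secondRow ∶
      ones (toℕ i) ++ [] ∣ 𝟏 ∷ ones (rest i) ++ sep ∷ body , 0 ⇒
      ones (toℕ i) ++ [] ∣ 𝟏 ∷ ones (rest i) ++ sep ∷ body , 0 ! secondOut i
    secondRow-run i =
      sweep-diagonal i body _ _ start m≤c ▹ sweep-diagonal i body _ _ start m≤c ▹
      scanRow-run readRed-reads i ▹ print-run [ sep ]

    thirdRow-run : ∀ j → thirdRow ∶
      ones (toℕ j) ++ sep ∷ ones m ++ [] ∣ 𝟏 ∷ ones (rest j) ++ sep ∷ table rows ++ K , 0 ⇒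
      ones (toℕ j) ++ sep ∷ ones m ++ [] ∣ 𝟏 ∷ ones (rest j) ++ sep ∷ table rows ++ K , 0 ! thirdOut j
    thirdRow-run j =
      output-≡
        (home-run (toℕ j) _ sep (≤-trans (<⇒≤ (toℕ<n j)) n≤c) ▹
         across-run m _ forbidden ▹ across-run m _ free ▹ away-run (toℕ j) _)
        (cong (times m forbidden ++_) (++-identityʳ _)) ▹
      sweep-diagonal j _ _ _ sep n≤c ▹ print-run [ sep ]

    -- The hypothesis speaks of the whole word rather than of the place of the head, since the
    -- second copy starts at the right end, where the first one stops.
    copyTail-run : ∀ {l xs v} H → l ʳ++ xs ≡ H ++ sep ∷ K →
      copyTail ∶ l ∣ xs , v ⇒ K ʳ++ sep ∷ (H ʳ++ []) ∣ [] , v ! K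
    copyTail-run {l} {xs} {v} H eq =
      land-≡ (toEnd l xs) (cong (_∣ []) reversed) ▹ go-run left ▹
      land-≡ (lefts (reverse K) [] (NoSep-ʳ++ K-NoSep [])) (cong (λ z → H ʳ++ [] ∣ sep ∷ z) (reverse-involutive K)) ▹ go-run right ▹
      copy K
      where
      reversed : xs ʳ++ l ≡ reverse K ++ sep ∷ (H ʳ++ [])
      reversed = begin
        xs ʳ++ l                       ≡⟨ cong (xs ʳ++_) (++-identityʳ l) ⟨
        xs ʳ++ l ++ []                 ≡⟨ ʳ++-ʳ++ l ⟨
        (l ʳ++ xs) ʳ++ []              ≡⟨ cong (_ʳ++ []) eq ⟩
        (H ++ sep ∷ K) ʳ++ []          ≡⟨ ++-ʳ++ H ⟩
        K ʳ++ sep ∷ (H ʳ++ [])         ≡⟨ ʳ++-defn K ⟩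
        reverse K ++ sep ∷ (H ʳ++ [])  ∎
        where open ≡-Reasoning
      toEnd : ∀ l xs → while (reading (not ∘ isEnd)) (go right) ∶ l ∣ xs , v ⇒ xs ʳ++ l ∣ [] , v ! []
      toEnd l []       = while-exit (reading (not ∘ isEnd)) refl
      toEnd l (x ∷ xs) = while-again (reading (not ∘ isEnd)) refl (go-run right) (toEnd (x ∷ l) xs)
      lefts : ∀ ys zs → NoSep ys → while (reading (not ∘ isSep)) (go left) ∶
              move left (ys ++ sep ∷ (H ʳ++ []) ∣ zs) , v ⇒ H ʳ++ [] ∣ sep ∷ (ys ʳ++ zs) , v ! []
      lefts []       zs []       = while-exit (reading (not ∘ isSep)) refl
      lefts (y ∷ ys) zs (p ∷ ps) =
        while-again (reading (not ∘ isSep)) (cong not p) (go-run left) (lefts ys (y ∷ zs) ps)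
      copy : ∀ {l} xs → while (reading (not ∘ isEnd)) (act letter right) ∶
             l ∣ xs , v ⇒ xs ʳ++ l ∣ [] , v ! xs
      copy []       = while-exit (reading (not ∘ isEnd)) refl
      copy (x ∷ xs) = while-again (reading (not ∘ isEnd)) refl (act-run letter right) (copy xs)

    ones-ʳ++ : ∀ k xs → ones k ʳ++ xs ≡ ones k ++ xs
    ones-ʳ++ zero    xs = refl
    ones-ʳ++ (suc k) xs = trans (ones-ʳ++ k (𝟏 ∷ xs)) (ones-shift k xs)

    rewound : ∀ k l xs → (ones k ++ l) ʳ++ xs ≡ l ʳ++ ones k ++ xs
    rewound k l xs = trans (++-ʳ++ (ones k)) (cong (l ʳ++_) (ones-ʳ++ k xs))

    fullyRewound : (ones n ++ sep ∷ ones m ++ []) ʳ++ sep ∷ table rows ++ K ≡ word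
    fullyRewound = trans (rewound n _ _) (rewound m [] _)

    -- The last separator closes the last row or, if there are no rows, the header. For this reason
    -- the word considered begins with the separator in front of the table.
    table-ends : ∀ {k} (ws : Fin k → List Sym) → ∃[ H ] sep ∷ table ws ++ K ≡ H ++ sep ∷ K
    table-ends {zero}  ws = [] , refl
    table-ends {suc k} ws with table-ends (ws ∘ suc)
    ... | H , eq = sep ∷ ws zero ++ H , cong (sep ∷_) (begin
      ((ws zero ++ [ sep ]) ++ table (ws ∘ suc)) ++ K  ≡⟨ cong (_++ K) (++-assoc (ws zero) _ _) ⟩
      (ws zero ++ sep ∷ table (ws ∘ suc)) ++ K         ≡⟨ ++-assoc (ws zero) _ _ ⟩
      ws zero ++ sep ∷ table (ws ∘ suc) ++ K           ≡⟨ cong (ws zero ++_) eq ⟩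
      ws zero ++ H ++ sep ∷ K                          ≡⟨ ++-assoc (ws zero) H _ ⟨
      (ws zero ++ H) ++ sep ∷ K                        ∎)
      where open ≡-Reasoning

    prefix : List Sym
    prefix = ones m ++ sep ∷ ones n ++ proj₁ (table-ends rows)

    word-ends : word ≡ prefix ++ sep ∷ K
    word-ends = begin
      ones m ++ sep ∷ ones n ++ sep ∷ table rows ++ K
        ≡⟨ cong (λ z → ones m ++ sep ∷ ones n ++ z) (proj₂ (table-ends rows)) ⟩
      ones m ++ sep ∷ ones n ++ H ++ sep ∷ K
        ≡⟨ cong (λ z → ones m ++ sep ∷ z) (++-assoc (ones n) H _) ⟨
      ones m ++ sep ∷ (ones n ++ H) ++ sep ∷ K
        ≡⟨ ++-assoc (ones m) _ _ ⟨
      prefix ++ sep ∷ K ∎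
      where
      open ≡-Reasoning
      H : List Sym
      H = proj₁ (table-ends rows)

    header-run : header ∶ [] ∣ word , 0 ⇒ [] ∣ word , 0 !
                 times m (𝟏 ∷ 𝟏 ∷ []) ++ times n [ 𝟏 ] ++ [ sep ]
    header-run =
      runOnes-run m body _ ▹ go-run right ▹ runOnes-run n _ _ ▹ print-run [ sep ] ▹
      land-≡ (toStart-run (ones n ++ sep ∷ ones m ++ []) (sep ∷ table rows ++ K)) (cong start fullyRewound) ▹ go-run right

    build-run : build ∶ [] ∣ word , 0 ⇒ ones n ++ sep ∷ ones m ++ [] ∣ sep ∷ table rows ++ K , 0 !
                tab firstOut ++ tab secondOut ++ tab thirdOut
    build-run =
      forEach-run m firstOut firstRow-run ▹
      land-≡ (toStart-run (ones m ++ []) (sep ∷ body)) (cong start (rewound m [] _)) ▹ go-run right ▹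
      forEach-run m secondOut secondRow-run ▹ go-run right ▹
      forEach-run n thirdOut thirdRow-run

    output : List Sym
    output =
      (times m (𝟏 ∷ 𝟏 ∷ []) ++ times n [ 𝟏 ] ++ [ sep ]) ++
      (tab firstOut ++ tab secondOut ++ tab thirdOut) ++
      K ++ sep ∷ K ++ slash ∷ encodeℕ 1

    bounds-run : ∀ {l xs v} H → l ʳ++ xs ≡ H ++ sep ∷ K →
                 bounds ∶ l ∣ xs , v ⇒ K ʳ++ sep ∷ (H ʳ++ []) ∣ [] , v ! K ++ sep ∷ K ++ slash ∷ encodeℕ 1
    bounds-run H eq =
      copyTail-run H eq ▹ print-run [ sep ] ▹ copyTail-run H again-ends ▹ print-run (slash ∷ encodeℕ 1)
      where
      again-ends : (K ʳ++ sep ∷ (H ʳ++ [])) ʳ++ [] ≡ H ++ sep ∷ K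
      again-ends =
        trans (ʳ++-ʳ++ K) (trans (ʳ++-ʳ++ H) (cong (λ z → H ++ sep ∷ z) (++-identityʳ K)))

    main-run : 1 ≤ s → ∃[ τ ] (cells (proj₂ τ) ≤ s ×
               _⊢_⇒_!_ s main (input (start word) , [] ⟨ ␣ ⟩ []) τ output)
    main-run 1≤s =
      let t , t-counter , e = run (go-run {h = start word} right ▹ header-run ▹ build-run ▹ bounds-run prefix (trans fullyRewound word-ends))
            (counter {0} {digits = []} refl nil z≤n z≤n)
      in (input (K ʳ++ sep ∷ (prefix ʳ++ []) ∣ []) , t) , counter-fits t-counter ,
         (onWork-run {f = keep} 1≤s refl _ ⨾ e)

-- Correctness of the reduction

∑ : ∀ {n} → (Fin n → ℕ) → ℕ
∑ = sum ℕ.+-0-rawMonoid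

indicator : Bool → ℕ
indicator b = if b then 1 else 0

∑-cong : ∀ {n} {f g : Fin n → ℕ} → (∀ i → f i ≡ g i) → ∑ f ≡ ∑ g
∑-cong {zero}  eq = refl
∑-cong {suc n} eq = cong₂ _+_ (eq zero) (∑-cong (eq ∘ suc))

∑-zero : ∀ {n} {f : Fin n → ℕ} → (∀ i → f i ≡ 0) → ∑ f ≡ 0
∑-zero {zero}  eq = refl
∑-zero {suc n} eq = cong₂ _+_ (eq zero) (∑-zero (eq ∘ suc))

∑-++ : ∀ m {n} (f : Fin (m + n) → ℕ) → ∑ f ≡ ∑ (λ i → f (i ↑ˡ n)) + ∑ (λ j → f (m ↑ʳ j))
∑-++ zero    f = refl
∑-++ (suc m) f = trans (cong (f zero +_) (∑-++ m (f ∘ suc))) (≡-sym (+-assoc (f zero) _ _))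

¬T⇒false : ∀ {b} → ¬ T b → b ≡ false
¬T⇒false {false} _ = refl
¬T⇒false {true}  h = contradiction tt h

-- Only the uniqueness of `j` is assumed, and `p j` may well be false. Hence it applies to the
-- diagonal of `M₁ ∩ M₂` and to the red part of a row of a matching alike.
∑-single : ∀ {n} (p : Fin n → Bool) j → (∀ {i} → T (p i) → j ≡ i) →
           ∑ (indicator ∘ p) ≡ indicator (p j)
∑-single p zero    unique = trans
  (cong (indicator (p zero) +_)
    (∑-zero {f = indicator ∘ p ∘ suc} λ i → cong indicator (¬T⇒false (0≢1+n ∘ unique))))
  (+-identityʳ _)
∑-single p (suc j) unique =
  cong₂ _+_ (cong indicator (¬T⇒false (0≢1+n ∘ ≡-sym ∘ unique)))
    (∑-single (p ∘ suc) j (suc-injective ∘ unique))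

-- Addition of rationals normalises; on unnormalised fractions only an identity between integers
-- over the denominator 1 remains.
fromℤ-+ : ∀ a b → fromℤ (ℤ.+ a) ℚ.+ fromℤ (ℤ.+ b) ≡ fromℤ (ℤ.+ (a + b))
fromℤ-+ a b = ℚ.toℚᵘ-injective
  (ℚᵘ.≃-trans (ℚ.toℚᵘ-homo-+ (fromℤ (ℤ.+ a)) (fromℤ (ℤ.+ b))) (ℚᵘ.*≡* eq))
  where
  eq : ((ℤ.+ a) ℤ.* (ℤ.+ 1) ℤ.+ (ℤ.+ b) ℤ.* (ℤ.+ 1)) ℤ.* (ℤ.+ 1) ≡ (ℤ.+ (a + b)) ℤ.* (ℤ.+ 1)
  eq = cong (ℤ._* (ℤ.+ 1)) (cong₂ ℤ._+_ (ℤ.*-identityʳ (ℤ.+ a)) (ℤ.*-identityʳ (ℤ.+ b)))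

fromℤ-cancel-≤ : ∀ {i j} → fromℤ i ℚ.≤ fromℤ j → i ℤ.≤ j
fromℤ-cancel-≤ {i} {j} (ℚ.*≤* p) = subst₂ ℤ._≤_ (ℤ.*-identityʳ i) (ℤ.*-identityʳ j) p

∑⁺ : ∀ {n} → (Fin n → Cost) → Cost
∑⁺ = sum +⁺-rawMonoid

integral : ℕ → Cost
integral n = fin (fromℤ (ℤ.+ n))

∑⁺-integral : ∀ {n} (f : Fin n → Cost) (w : Fin n → ℕ) → (∀ i → f i ≡ integral (w i)) → ∑⁺ f ≡ integral (∑ w)
∑⁺-integral {zero}  f w eq = refl
∑⁺-integral {suc n} f w eq rewrite eq zero | ∑⁺-integral (f ∘ suc) (w ∘ suc) (eq ∘ suc) =
  cong fin (fromℤ-+ (w zero) (∑ (w ∘ suc)))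

data IsFinite : Cost → Set where
  finite : ∀ {q} → IsFinite (fin q)

+⁺-finite : ∀ x y → IsFinite (x +⁺ y) → IsFinite x × IsFinite y
+⁺-finite (fin _) (fin _) _ = finite , finite

∑⁺-finite : ∀ {n} (f : Fin n → Cost) → IsFinite (∑⁺ f) → ∀ i → IsFinite (f i)
∑⁺-finite f h zero    = proj₁ (+⁺-finite (f zero) _ h)
∑⁺-finite f h (suc i) = ∑⁺-finite (f ∘ suc) (proj₂ (+⁺-finite (f zero) _ h)) i

≤⁺-finite : ∀ {x q} → x ≤⁺ fin q → IsFinite x
≤⁺-finite AddSup.[ _ ] = finite

-- The three kinds of vertices on each side of the new graph

Vertex : ℕ → ℕ → Set
Vertex m n = Fin m ⊎ (Fin m ⊎ Fin n)

pattern first i  = inj₁ i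
pattern second i = inj₂ (inj₁ i)
pattern third j  = inj₂ (inj₂ j)

module Vertices (m n : ℕ) where

  vertex : Fin (m + (m + n)) → Vertex m n
  vertex x = Sum.map₂ (splitAt m) (splitAt m x)

  index : Vertex m n → Fin (m + (m + n))
  index (first i)  = i ↑ˡ (m + n)
  index (second i) = m ↑ʳ (i ↑ˡ n)
  index (third j)  = m ↑ʳ (m ↑ʳ j)

  vertex-index : ∀ a → vertex (index a) ≡ a
  vertex-index (first i)  = cong (Sum.map₂ (splitAt m)) (splitAt-↑ˡ m i (m + n))
  vertex-index (second i) = trans (cong (Sum.map₂ (splitAt m)) (splitAt-↑ʳ m (m + n) (i ↑ˡ n)))
                              (cong inj₂ (splitAt-↑ˡ m i n))
  vertex-index (third j)  = trans (cong (Sum.map₂ (splitAt m)) (splitAt-↑ʳ m (m + n) (m ↑ʳ j)))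
                              (cong inj₂ (splitAt-↑ʳ m n j))

  index-vertex : ∀ x → index (vertex x) ≡ x
  index-vertex x with splitAt m x in eq
  ... | inj₁ i = trans (cong (join m (m + n)) (≡-sym eq)) (join-splitAt m (m + n) x)
  ... | inj₂ y with splitAt m y in eq′
  ...   | inj₁ i = trans (cong (m ↑ʳ_) (trans (cong (join m n) (≡-sym eq′)) (join-splitAt m n y)))
                     (trans (cong (join m (m + n)) (≡-sym eq)) (join-splitAt m (m + n) x))
  ...   | inj₂ j = trans (cong (m ↑ʳ_) (trans (cong (join m n) (≡-sym eq′)) (join-splitAt m n y)))
                     (trans (cong (join m (m + n)) (≡-sym eq)) (join-splitAt m (m + n) x))

  ∑-vertex : ∀ (f : Vertex m n → ℕ) → ∑ (f ∘ vertex) ≡ ∑ (f ∘ inj₁) + (∑ (f ∘ inj₂ ∘ inj₁) + ∑ (f ∘ inj₂ ∘ inj₂))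
  ∑-vertex f = trans (∑-++ m (f ∘ vertex)) (cong₂ _+_
    (∑-cong (cong f ∘ vertex-index ∘ inj₁))
    (trans (∑-++ m _) (cong₂ _+_
      (∑-cong (cong f ∘ vertex-index ∘ inj₂ ∘ inj₁)) (∑-cong (cong f ∘ vertex-index ∘ inj₂ ∘ inj₂)))))

  same : Vertex m n → Vertex m n → Bool
  same (first i)  (first j)  = does (i ≟ j)
  same (second i) (second j) = does (i ≟ j)
  same (third i)  (third j)  = does (i ≟ j)
  same _          _          = false

  does⇒≡ : ∀ {k} {i j : Fin k} → T (does (i ≟ j)) → i ≡ j
  does⇒≡ {i = i} {j} h with i ≟ j
  ... | yes eq = eq

  does-refl : ∀ {k} (i : Fin k) → T (does (i ≟ i))
  does-refl i rewrite dec-true (i ≟ i) refl = tt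

  same⇒≡ : ∀ {a b} → T (same a b) → a ≡ b
  same⇒≡ {first _}  {first _}  h = cong inj₁ (does⇒≡ h)
  same⇒≡ {second _} {second _} h = cong (inj₂ ∘ inj₁) (does⇒≡ h)
  same⇒≡ {third _}  {third _}  h = cong (inj₂ ∘ inj₂) (does⇒≡ h)

  same-refl : ∀ a → T (same a a)
  same-refl (first i)  = does-refl i
  same-refl (second i) = does-refl i
  same-refl (third i)  = does-refl i

  fromVertices : (Vertex m n → Vertex m n → Bool) → EdgeSet (m + (m + n)) (m + (m + n))
  fromVertices M x y = M (vertex x) (vertex y)

  perfect : (M : Vertex m n → Vertex m n → Bool) →
            (∀ a → ∃[ b ] (T (M a b) × (∀ {b′} → T (M a b′) → b ≡ b′))) →
            (∀ b → ∃[ a ] (T (M a b) × (∀ {a′} → T (M a′ b) → a ≡ a′))) →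
            IsPerfectMatching (complete _) (fromVertices M)
  perfect M l r = record
    { subset  = λ _ _ _ → tt
    ; coversˡ = λ x → let b , e , u = l (vertex x) in
        index b , subst (T ∘ M (vertex x)) (≡-sym (vertex-index b)) e ,
        λ {y} h → trans (cong index (u h)) (index-vertex y)
    ; coversʳ = λ y → let a , e , u = r (vertex y) in
        index a , subst (λ z → T (M z (vertex y))) (≡-sym (vertex-index a)) e ,
        λ {x} h → trans (cong index (u h)) (index-vertex x)
    }

  identity-perfect : IsPerfectMatching (complete _) (fromVertices same)
  identity-perfect = perfect same
    (λ a → a , same-refl a , same⇒≡) (λ a → a , same-refl a , λ h → ≡-sym (same⇒≡ h))

T-∧⁻ : ∀ {a b} → T (a ∧ b) → T a × T b
T-∧⁻ {true} h = tt , h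

T-∧⁺ : ∀ {a b} → T a → T b → T (a ∧ b)
T-∧⁺ {true} _ h = h

T-not : ∀ {b} → T (not b) → b ≡ true → ⊥
T-not h refl = h

-- On the left, first i and second i are the two copies of the i-th vertex
-- of U and third j is a filler; on the right, first i is the new vertex
-- joined to both copies, second i is a filler, and third j is the j-th
-- vertex of V.  M₁ pairs equal vertices, so that thanks to the fillers it
-- contains no edge of finite cost but those from first i to first i.
module Reduction {m n : ℕ} (E R : EdgeSet m n) where
  open Vertices m n

  weight : Vertex m n → Vertex m n → Maybe ℕ
  weight (first i)  (first j)  = if does (i ≟ j) then just 1 else nothing
  weight (first i)  (third j)  = if E i j ∧ not (R i j) then just 0 else nothing
  weight (second i) (first j)  = if does (i ≟ j) then just 0 else nothing
  weight (second i) (third j)  = if R i j then just 0 else nothing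
  weight (third j)  (second i) = just 0
  weight _          _          = nothing

  toCost : Maybe ℕ → Cost
  toCost (just w) = integral w
  toCost nothing  = ⊤⁺

  cost : Fin (m + (m + n)) → Fin (m + (m + n)) → Cost
  cost x y = toCost (weight (vertex x) (vertex y))

  M₁ : EdgeSet (m + (m + n)) (m + (m + n))
  M₁ = fromVertices same

  -- On pairs of kind first-first a finite weight means equal vertices and is 1. All other finite
  -- weights are 0 and join vertices of different kinds, for which `same` is false by definition.
  weight≡same : ∀ a b {w} → weight a b ≡ just w → w ≡ indicator (same a b)
  weight≡same (first i)  (first j)  eq with does (i ≟ j)
  weight≡same (first i)  (first j)  refl | true = refl
  weight≡same (first i)  (third j)  eq with E i j ∧ not (R i j)
  weight≡same (first i)  (third j)  refl | true = refl
  weight≡same (second i) (first j)  eq with does (i ≟ j)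
  weight≡same (second i) (first j)  refl | true = refl
  weight≡same (second i) (third j)  eq with R i j
  weight≡same (second i) (third j)  refl | true = refl
  weight≡same (third j)  (second i) refl = refl

  Allowed : EdgeSet (m + (m + n)) (m + (m + n)) → Set
  Allowed M₂ = ∀ x y → T (M₂ x y) → IsFinite (cost x y)

  cost-sum : ∀ M₂ → Allowed M₂ → sumOver +⁺-rawMonoid M₂ cost ≡ integral ∣ M₁ ∩ M₂ ∣
  cost-sum M₂ allowed =
    ∑⁺-integral _ (λ x → ∑ (λ y → indicator (M₁ x y ∧ M₂ x y))) λ x →
    ∑⁺-integral _ (λ y → indicator (M₁ x y ∧ M₂ x y)) λ y → term x y
    where
    term : ∀ x y → (if M₂ x y then cost x y else fin 0ℚ) ≡ integral (indicator (M₁ x y ∧ M₂ x y))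
    term x y with M₂ x y | allowed x y
    ... | false | _ = cong (integral ∘ indicator) (≡-sym (∧-zeroʳ (M₁ x y)))
    ... | true  | h with weight (vertex x) (vertex y) in eq | h tt
    ...   | just w | _ = cong integral
      (trans (weight≡same (vertex x) (vertex y) eq) (cong indicator (≡-sym (∧-identityʳ (M₁ x y)))))

  -- Since +∞ is absorbing, a sum below a rational has finite terms only. The bound on the cost thus
  -- acts twice: qualitatively here, and through its value in `yes⇔`.
  allowed-of-bounded : ∀ {q} M₂ → sumOver +⁺-rawMonoid M₂ cost ≤⁺ fin q → Allowed M₂
  allowed-of-bounded M₂ p x y h = used (M₂ x y) h (∑⁺-finite _ (∑⁺-finite _ (≤⁺-finite p) x) y)
    where
    used : ∀ b → T b → IsFinite (if b then cost x y else fin 0ℚ) → IsFinite (cost x y)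
    used true _ f = f

  infinite-diagonal : ∀ a → (∀ i → ¬ a ≡ first i) → ¬ IsFinite (toCost (weight a a))
  infinite-diagonal (first i)  ne _ = ne i refl
  infinite-diagonal (second _) ne ()
  infinite-diagonal (third _)  ne ()

  module _ (M₂ : EdgeSet (m + (m + n)) (m + (m + n))) (allowed : Allowed M₂) where

    M₂′ : Vertex m n → Vertex m n → Bool
    M₂′ a b = M₂ (index a) (index b)

    allowed′ : ∀ a b → T (M₂′ a b) → IsFinite (toCost (weight a b))
    allowed′ a b h = subst₂ (λ a b → IsFinite (toCost (weight a b)))
      (vertex-index a) (vertex-index b) (allowed (index a) (index b) h)

    -- Being the identity, `M₁` confines the sum to the diagonal, where the entries of the second
    -- and third kind have infinite cost and so are absent from `M₂`.
    common : ∣ M₁ ∩ M₂ ∣ ≡ ∑ (λ i → indicator (M₂′ (first i) (first i)))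
    common = begin
      ∣ M₁ ∩ M₂ ∣
        ≡⟨ ∑-cong (λ x → trans
             (∑-single (λ y → M₁ x y ∧ M₂ x y) x (λ h → vertex-injective (same⇒≡ (proj₁ (T-∧⁻ h)))))
             (cong (λ b → indicator (b ∧ M₂ x x)) (Equivalence.to T-≡ (same-refl (vertex x))))) ⟩
      ∑ (λ x → indicator (M₂ x x))
        ≡⟨ ∑-cong {f = λ x → indicator (M₂ x x)} (λ x → cong (λ z → indicator (M₂ z z)) (≡-sym (index-vertex x))) ⟩
      ∑ ((λ a → indicator (M₂′ a a)) ∘ vertex)
        ≡⟨ ∑-vertex (λ a → indicator (M₂′ a a)) ⟩
      ∑ (λ i → indicator (M₂′ (first i) (first i))) +
      (∑ (λ i → indicator (M₂′ (second i) (second i))) + ∑ (λ j → indicator (M₂′ (third j) (third j))))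
        ≡⟨ cong (∑ (λ i → indicator (M₂′ (first i) (first i))) +_) (cong₂ _+_
             (∑-zero (λ i → unused (second i) (λ _ ())))
             (∑-zero (λ j → unused (third j) (λ _ ())))) ⟩
      ∑ (λ i → indicator (M₂′ (first i) (first i))) + 0
        ≡⟨ +-identityʳ _ ⟩
      ∑ (λ i → indicator (M₂′ (first i) (first i))) ∎
      where
      open ≡-Reasoning
      vertex-injective : ∀ {x y} → vertex x ≡ vertex y → x ≡ y
      vertex-injective {x} {y} eq = trans (≡-sym (index-vertex x)) (trans (cong index eq) (index-vertex y))
      unused : ∀ a → (∀ i → ¬ a ≡ first i) → indicator (M₂′ a a) ≡ 0
      unused a ne = cong indicator (¬T⇒false (λ h → infinite-diagonal a ne (allowed′ a a h)))

  module Forward (M : EdgeSet m n) (pm : IsPerfectMatching E M) where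
    open IsPerfectMatching pm

    partner : Fin m → Fin n
    partner i = proj₁ (coversˡ i)

    matched : ∀ i → T (M i (partner i))
    matched i = proj₁ (proj₂ (coversˡ i))

    partner-unique : ∀ {i j} → T (M i j) → partner i ≡ j
    partner-unique {i} = proj₂ (proj₂ (coversˡ i))

    red : Fin m → Bool
    red i = R i (partner i)

    red≡ : ∀ {i j} → T (M i j) → R i j ≡ red i
    red≡ {i} h = cong (R i) (≡-sym (partner-unique h))

    -- The fillers `third j` and `second i` are joined completely at cost 0, so any perfect matching
    -- between them would do; `M` itself is one that is at hand.
    N : Vertex m n → Vertex m n → Bool
    N (first i)  (first j)  = does (i ≟ j) ∧ red i
    N (first i)  (third j)  = M i j ∧ not (R i j)
    N (second i) (first j)  = does (i ≟ j) ∧ not (red i)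
    N (second i) (third j)  = M i j ∧ R i j
    N (third j)  (second i) = M i j
    N _          _          = false

    N-rows : ∀ a → ∃[ b ] (T (N a b) × (∀ {b′} → T (N a b′) → b ≡ b′))
    N-rows (first i) with red i in eq
    ... | true  = first i , T-∧⁺ (does-refl i) (subst T (≡-sym eq) tt) , λ
      { {first _} h → cong inj₁ (does⇒≡ (proj₁ (T-∧⁻ h)))
      ; {third _} h → ⊥-elim (T-not (proj₂ (T-∧⁻ h)) (trans (red≡ (proj₁ (T-∧⁻ h))) eq)) }
    ... | false = third (partner i) , T-∧⁺ (matched i) (subst (T ∘ not) (≡-sym eq) tt) , λ
      { {first j} h → ⊥-elim (subst T eq (proj₂ (T-∧⁻ {does (i ≟ j)} h)))
      ; {third _} h → cong (inj₂ ∘ inj₂) (partner-unique (proj₁ (T-∧⁻ h))) }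
    N-rows (second i) with red i in eq
    ... | false = first i , T-∧⁺ (does-refl i) (subst (T ∘ not) (≡-sym eq) tt) , λ
      { {first _} h → cong inj₁ (does⇒≡ (proj₁ (T-∧⁻ h)))
      ; {third _} h → ⊥-elim (subst T (trans (red≡ (proj₁ (T-∧⁻ h))) eq) (proj₂ (T-∧⁻ h))) }
    ... | true  = third (partner i) , T-∧⁺ (matched i) (subst T (≡-sym eq) tt) , λ
      { {first j} h → ⊥-elim (T-not (proj₂ (T-∧⁻ {does (i ≟ j)} h)) eq)
      ; {third _} h → cong (inj₂ ∘ inj₂) (partner-unique (proj₁ (T-∧⁻ h))) }
    N-rows (third j) with coversʳ j
    ... | i , h , unique = second i , h , λ { {second _} h → cong (inj₂ ∘ inj₁) (unique h) }

    N-columns : ∀ b → ∃[ a ] (T (N a b) × (∀ {a′} → T (N a′ b) → a ≡ a′))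
    N-columns (first j) with red j in eq
    ... | true  = first j , T-∧⁺ (does-refl j) (subst T (≡-sym eq) tt) , λ
      { {first _}  h → cong inj₁ (≡-sym (does⇒≡ (proj₁ (T-∧⁻ h))))
      ; {second i} h → ⊥-elim (T-not (proj₂ (T-∧⁻ h)) (trans (cong red (does⇒≡ {i = i} (proj₁ (T-∧⁻ h)))) eq)) }
    ... | false = second j , T-∧⁺ (does-refl j) (subst (T ∘ not) (≡-sym eq) tt) , λ
      { {first i}  h → ⊥-elim (subst T (trans (cong red (does⇒≡ {i = i} (proj₁ (T-∧⁻ h)))) eq) (proj₂ (T-∧⁻ h)))
      ; {second _} h → cong (inj₂ ∘ inj₁) (≡-sym (does⇒≡ (proj₁ (T-∧⁻ h)))) }
    N-columns (second i) = third (partner i) , matched i , λ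
      { {third _} h → cong (inj₂ ∘ inj₂) (partner-unique h) }
    N-columns (third j) with coversʳ j
    ... | i , h , unique with R i j in eq
    ...   | false = first i , T-∧⁺ h (subst (T ∘ not) (≡-sym eq) tt) , λ
      { {first _}  h′ → cong inj₁ (unique (proj₁ (T-∧⁻ h′)))
      ; {second _} h′ → ⊥-elim (subst T
          (trans (cong (λ z → R z j) (≡-sym (unique (proj₁ (T-∧⁻ h′))))) eq) (proj₂ (T-∧⁻ h′))) }
    ...   | true  = second i , T-∧⁺ h (subst T (≡-sym eq) tt) , λ
      { {first _}  h′ → ⊥-elim (T-not (proj₂ (T-∧⁻ h′))
          (trans (cong (λ z → R z j) (≡-sym (unique (proj₁ (T-∧⁻ h′))))) eq))
      ; {second _} h′ → cong (inj₂ ∘ inj₁) (unique (proj₁ (T-∧⁻ h′))) }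

    N-allowed : ∀ a b → T (N a b) → IsFinite (toCost (weight a b))
    N-allowed (first i) (first j) h with does (i ≟ j)
    ... | true = finite
    N-allowed (first i) (third j) h
      rewrite Equivalence.to T-≡ (T-∧⁺ (subset i j (proj₁ (T-∧⁻ h))) (proj₂ (T-∧⁻ {M i j} h))) = finite
    N-allowed (second i) (first j) h with does (i ≟ j)
    ... | true = finite
    N-allowed (second i) (third j) h rewrite Equivalence.to T-≡ (proj₂ (T-∧⁻ {M i j} h)) = finite
    N-allowed (third j) (second i) h = finite

    M₂ : EdgeSet (m + (m + n)) (m + (m + n))
    M₂ = fromVertices N

    M₂-allowed : Allowed M₂
    M₂-allowed x y = N-allowed (vertex x) (vertex y)

    M₂-perfect : IsPerfectMatching (complete _) M₂
    M₂-perfect = perfect N N-rows N-columns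

    common≡red : ∣ M₁ ∩ M₂ ∣ ≡ ∣ M ∩ R ∣
    common≡red = begin
      ∣ M₁ ∩ M₂ ∣
        ≡⟨ common M₂ M₂-allowed ⟩
      ∑ (λ i → indicator (M₂ (index (first i)) (index (first i))))
        ≡⟨ ∑-cong (λ i → cong (λ a → indicator (N a a)) (vertex-index (first i))) ⟩
      ∑ (λ i → indicator (does (i ≟ i) ∧ red i))
        ≡⟨ ∑-cong (λ i → cong (λ b → indicator (b ∧ red i))
             (trans (dec-true (i ≟ i) refl) (≡-sym (Equivalence.to T-≡ (matched i))))) ⟩
      ∑ (λ i → indicator (M i (partner i) ∧ R i (partner i)))
        ≡⟨ ∑-cong (λ i → ∑-single (λ j → M i j ∧ R i j) (partner i) (partner-unique ∘ proj₁ ∘ T-∧⁻)) ⟨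
      ∣ M ∩ R ∣ ∎
      where open ≡-Reasoning

  module Backward (R⊆E : R ⊆ E) (M₂ : EdgeSet (m + (m + n)) (m + (m + n)))
                  (pm : IsPerfectMatching (complete _) M₂) (allowed : Allowed M₂) where
    open IsPerfectMatching pm

    N : Vertex m n → Vertex m n → Bool
    N = M₂′ M₂ allowed

    N-allowed : ∀ a b → T (N a b) → IsFinite (toCost (weight a b))
    N-allowed = allowed′ M₂ allowed

    index-injective : ∀ {a b} → index a ≡ index b → a ≡ b
    index-injective {a} {b} eq = trans (≡-sym (vertex-index a)) (trans (cong vertex eq) (vertex-index b))

    row : ∀ a → ∃[ b ] T (N a b)
    row a with coversˡ (index a)
    ... | y , h , _ = vertex y , subst (T ∘ M₂ (index a)) (≡-sym (index-vertex y)) h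

    row-unique : ∀ {a b c} → T (N a b) → T (N a c) → b ≡ c
    row-unique {a} h h′ with coversˡ (index a)
    ... | _ , _ , unique = index-injective (trans (≡-sym (unique h)) (unique h′))

    column : ∀ b → ∃[ a ] T (N a b)
    column b with coversʳ (index b)
    ... | x , h , _ = vertex x , subst (λ z → T (M₂ z (index b))) (≡-sym (index-vertex x)) h

    column-unique : ∀ {a b c} → T (N a c) → T (N b c) → a ≡ b
    column-unique {c = c} h h′ with coversʳ (index c)
    ... | _ , _ , unique = index-injective (trans (≡-sym (unique h)) (unique h′))

    M : EdgeSet m n
    M i j = N (first i) (third j) ∨ N (second i) (third j)

    finite-if : ∀ b {w} → IsFinite (toCost (if b then just w else nothing)) → T b
    finite-if true _ = tt

    blue : ∀ {i j} → T (N (first i) (third j)) → T (E i j) × T (not (R i j))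
    blue {i} {j} h = T-∧⁻ (finite-if _ (N-allowed (first i) (third j) h))

    red : ∀ {i j} → T (N (second i) (third j)) → T (R i j)
    red {i} {j} h = finite-if _ (N-allowed (second i) (third j) h)

    first-neighbour : ∀ i b → T (N (first i) b) → b ≡ first i ⊎ ∃[ j ] b ≡ third j
    first-neighbour i (first j)  h =
      inj₁ (cong inj₁ (≡-sym (does⇒≡ (finite-if _ (N-allowed (first i) (first j) h)))))
    first-neighbour i (second j) h with N-allowed (first i) (second j) h
    ... | ()
    first-neighbour i (third j)  h = inj₂ (j , refl)

    second-neighbour : ∀ i b → T (N (second i) b) → b ≡ first i ⊎ ∃[ j ] b ≡ third j
    second-neighbour i (first j)  h =
      inj₁ (cong inj₁ (≡-sym (does⇒≡ (finite-if _ (N-allowed (second i) (first j) h)))))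
    second-neighbour i (second j) h with N-allowed (second i) (second j) h
    ... | ()
    second-neighbour i (third j)  h = inj₂ (j , refl)

    first-column : ∀ i a → T (N a (first i)) → a ≡ first i ⊎ a ≡ second i
    first-column i (first j)  h =
      inj₁ (cong inj₁ (does⇒≡ (finite-if _ (N-allowed (first j) (first i) h))))
    first-column i (second j) h =
      inj₂ (cong (inj₂ ∘ inj₁) (does⇒≡ (finite-if _ (N-allowed (second j) (first i) h))))
    first-column i (third j)  h with N-allowed (third j) (first i) h
    ... | ()

    third-column : ∀ j a → T (N a (third j)) → ∃[ i ] (a ≡ first i ⊎ a ≡ second i)
    third-column j (first i)  h = i , inj₁ refl
    third-column j (second i) h = i , inj₂ refl
    third-column j (third i)  h with N-allowed (third i) (third j) h
    ... | ()

    -- The two copies of i share the column of their new vertex, so exactly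
    -- one of them is matched into V.
    data Choice (i : Fin m) : Set where
      takesRed  : ∀ j → T (N (first i) (first i)) → T (N (second i) (third j)) → Choice i
      takesBlue : ∀ j → T (N (first i) (third j)) → T (N (second i) (first i)) → Choice i

    choice : ∀ i → Choice i
    -- The rows alone would allow both copies of `i` to be matched into V; that the column of the
    -- new vertex is covered excludes it.
    choice i with row (first i) | row (second i) | column (first i)
    ... | b , h | b′ , h′ | a , h″ with first-neighbour i b h | second-neighbour i b′ h′ | first-column i a h″
    ... | inj₁ refl | inj₂ (j , refl) | _ = takesRed j h h′
    ... | inj₂ (j , refl) | _ | inj₂ refl = takesBlue j h h″
    ... | inj₁ refl | inj₁ refl | _ with column-unique {first i} {second i} {first i} h h′
    ...   | ()
    choice i | b , h | b′ , h′ | a , h″ | inj₂ (j , refl) | _ | inj₁ refl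
      with row-unique {first i} {third j} {first i} h h″
    ...   | ()

    split : ∀ {i j} → T (M i j) → T (N (first i) (third j)) ⊎ T (N (second i) (third j))
    split {i} {j} = Equivalence.to (T-∨ {N (first i) (third j)})

    toBlue : ∀ {i j} → T (N (first i) (third j)) → T (M i j)
    toBlue h = Equivalence.from T-∨ (inj₁ h)

    toRed : ∀ {i j} → T (N (second i) (third j)) → T (M i j)
    toRed {i} {j} h = Equivalence.from (T-∨ {N (first i) (third j)}) (inj₂ h)

    third-injective : ∀ {j j′} → _≡_ {A = Vertex m n} (third j) (third j′) → j ≡ j′
    third-injective refl = refl

    -- The last component compares the two counts locally: the diagonal entry of `i` is used exactly
    -- if the edge of `M` at `i` is red. Summed over the rows it yields `common≡red`.
    chosen : ∀ i → ∃[ j ] (T (M i j) × (∀ {j′} → T (M i j′) → j ≡ j′) ×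
                           indicator (N (first i) (first i)) ≡ indicator (M i j ∧ R i j))
    chosen i with choice i
    ... | takesRed j h h′ = j , toRed h′ , unique , cong indicator
      (trans (Equivalence.to T-≡ h) (≡-sym (Equivalence.to T-≡ (T-∧⁺ (toRed h′) (red h′)))))
      where
      unique : ∀ {j′} → T (M i j′) → j ≡ j′
      unique {j′} h″ with split h″
      ... | inj₁ x with row-unique {first i} {first i} {third j′} h x
      ...   | ()
      unique {j′} h″ | inj₂ x = third-injective (row-unique {second i} {third j} {third j′} h′ x)
    ... | takesBlue j h h′ = j , toBlue h , unique , cong indicator (trans
      (¬T⇒false (λ x → third≢first (row-unique {first i} {third j} {first i} h x)))
      (≡-sym (trans (cong (M i j ∧_) (¬T⇒false (λ x → T-not (proj₂ (blue h)) (Equivalence.to T-≡ x))))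
        (∧-zeroʳ (M i j)))))
      where
      third≢first : ∀ {j i} → ¬ _≡_ {A = Vertex m n} (third j) (first i)
      third≢first ()
      unique : ∀ {j′} → T (M i j′) → j ≡ j′
      unique {j′} h″ with split h″
      ... | inj₁ x = third-injective (row-unique {first i} {third j} {third j′} h x)
      ... | inj₂ x with row-unique {second i} {first i} {third j′} h′ x
      ...   | ()

    M-column : ∀ j → ∃[ i ] (T (M i j) × (∀ {i′} → T (M i′ j) → i ≡ i′))
    M-column j with column (third j)
    ... | a , h with third-column j a h
    ... | i , inj₁ refl = i , toBlue h , unique
      where
      unique : ∀ {i′} → T (M i′ j) → i ≡ i′
      unique {i′} h′ with split h′
      ... | inj₁ x with column-unique {first i} {first i′} {third j} h x
      ...   | refl = refl
      unique {i′} h′ | inj₂ x with column-unique {first i} {second i′} {third j} h x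
      ...   | ()
    ... | i , inj₂ refl = i , toRed h , unique
      where
      unique : ∀ {i′} → T (M i′ j) → i ≡ i′
      unique {i′} h′ with split h′
      ... | inj₂ x with column-unique {second i} {second i′} {third j} h x
      ...   | refl = refl
      unique {i′} h′ | inj₁ x with column-unique {second i} {first i′} {third j} h x
      ...   | ()

    M-perfect : IsPerfectMatching E M
    M-perfect = record
      { subset  = λ i j h → Sum.[ proj₁ ∘ blue , R⊆E i j ∘ red ] (split h)
      ; coversˡ = λ i → let j , h , u , _ = chosen i in j , h , u
      ; coversʳ = M-column
      }

    common≡red : ∣ M₁ ∩ M₂ ∣ ≡ ∣ M ∩ R ∣
    common≡red = begin
      ∣ M₁ ∩ M₂ ∣                                ≡⟨ common M₂ allowed ⟩
      ∑ (λ i → indicator (N (first i) (first i)))  ≡⟨ ∑-cong (λ i → row-count i) ⟩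
      ∣ M ∩ R ∣                                  ∎
      where
      open ≡-Reasoning
      row-count : ∀ i → indicator (N (first i) (first i)) ≡ ∑ (λ j → indicator (M i j ∧ R i j))
      row-count i with chosen i
      ... | j , _ , unique , eq =
        trans eq (≡-sym (∑-single (λ j → M i j ∧ R i j) j (unique ∘ proj₁ ∘ T-∧⁻)))

  yes⇔ : R ⊆ E → ∀ k →
    (∃[ M ] (IsPerfectMatching E M × ℤ.+ ∣ M ∩ R ∣ ≡ k)) ⇔
    (∃[ M₂ ] (IsPerfectMatching (complete (m + (m + n))) M₂ ×
              k ℤ.≤ ℤ.+ ∣ M₁ ∩ M₂ ∣ × sumOver +⁺-rawMonoid M₂ cost ≤⁺ fin (fromℤ k)))
  yes⇔ R⊆E k = mk⇔ forward backward
    where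
    forward : _ → _
    forward (M , pm , refl) =
      M₂ , M₂-perfect , ℤ.≤-reflexive (cong ℤ.+_ (≡-sym common≡red)) ,
      subst (_≤⁺ fin (fromℤ k)) (≡-sym (trans (cost-sum M₂ M₂-allowed) (cong integral common≡red)))
        AddSup.[ ℚ.≤-refl ]
      where open Forward M pm
    backward : _ → _
    backward (M₂ , pm , k≤ , cost≤) =
      M , M-perfect , trans (cong ℤ.+_ (≡-sym common≡red)) (ℤ.≤-antisym ≤k k≤)
      where
      allowed = allowed-of-bounded M₂ cost≤
      open Backward R⊆E M₂ pm allowed
      ≤k : ℤ.+ ∣ M₁ ∩ M₂ ∣ ℤ.≤ k
      ≤k with subst (_≤⁺ fin (fromℤ k)) (cost-sum M₂ allowed) cost≤
      ... | AddSup.[ p ] = fromℤ-cancel-≤ p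

-- The output of the program

encodeMatrix≡table : ∀ {m n} (e : Fin m → Fin n → List Sym) → encodeMatrix e ≡ table (tab ∘ e)
encodeMatrix≡table {m} e = trans (concatMap-tabulate {n = m} _ id)
  (tab-cong λ i → cong (_++ [ sep ]) (concatMap-tabulate (e i) id))

tab-++ : ∀ {A : Set} m {n} (f : Fin (m + n) → List A) →
         tab f ≡ tab (λ i → f (i ↑ˡ n)) ++ tab (λ j → f (m ↑ʳ j))
tab-++ zero    f = refl
tab-++ (suc m) f = trans (cong (f zero ++_) (tab-++ m (f ∘ suc))) (≡-sym (++-assoc (f zero) _ _))

module _ {m n : ℕ} where
  open Vertices m n

  tab-vertex : ∀ {A : Set} (f : Vertex m n → List A) →
    tab (f ∘ vertex) ≡ tab (λ i → f (first i)) ++ tab (λ i → f (second i)) ++ tab (λ j → f (third j))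
  tab-vertex f = trans (tab-++ m (f ∘ vertex)) (cong₂ _++_
    (tab-cong (λ i → cong f (vertex-index (first i))))
    (trans (tab-++ m _) (cong₂ _++_
      (tab-cong (λ i → cong f (vertex-index (second i)))) (tab-cong (λ j → cong f (vertex-index (third j)))))))

NoSep-digits : ∀ ds → NoSep (map encodeBit ds)
NoSep-digits []           = []
NoSep-digits (zero ∷ ds)  = refl ∷ NoSep-digits ds
NoSep-digits (suc _ ∷ ds) = refl ∷ NoSep-digits ds

NoSep-encodeℤ : ∀ k → NoSep (encodeℤ k)
NoSep-encodeℤ (ℤ.+ n)    = NoSep-digits (proj₁ (toDigits 2 n))
NoSep-encodeℤ ℤ.-[1+ n ] = refl ∷ NoSep-digits (proj₁ (toDigits 2 (suc n)))

-- Otherwise monotonicity of the logarithm, applied to the power, would give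
-- `suc ⌊log₂ n ⌋ ≤ ⌊log₂ n ⌋`.
<2^suc-log : ∀ n → n < 2 ^ suc ⌊log₂ n ⌋
<2^suc-log n = ≰⇒> λ h → 1+n≰n
  (subst (_≤ ⌊log₂ n ⌋) (⌊log₂[2^n]⌋≡n (suc ⌊log₂ n ⌋)) (⌊log₂⌋-mono-≤ h))

times-ones : ∀ m n → times m (𝟏 ∷ 𝟏 ∷ []) ++ times n [ 𝟏 ] ≡ ones (m + (m + n))
times-ones zero    zero    = refl
times-ones zero    (suc n) = cong (𝟏 ∷_) (times-ones zero n)
times-ones (suc m) n = cong (𝟏 ∷_) (trans (cong (𝟏 ∷_) (times-ones m n)) (cong ones (≡-sym (+-suc m (m + n)))))

-- The reduction, its space bound and the encoding of its value

reduce : RedBlueGraph → RecovAPInstance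
reduce G = record
  { M₁         = M₁
  ; M₁-perfect = Vertices.identity-perfect m n
  ; c₂         = cost
  ; k          = k
  ; B          = fromℤ k
  }
  where
  open RedBlueGraph G
  open Reduction E R

module Correct (G : RedBlueGraph) where
  open RedBlueGraph G
  open Vertices m n
  open Reduction E R

  w w′ : List Sym
  w  = DecisionProblem.encode ExactMatching G
  w′ = DecisionProblem.encode 2S-RecovAP (reduce G)

  w≡word : w ≡ ones m ++ sep ∷ ones n ++ sep ∷ table (λ i → pairs (E i) (R i)) ++ encodeℤ k
  w≡word = cong (λ z → ones m ++ sep ∷ ones n ++ sep ∷ z ++ encodeℤ k)
    (encodeMatrix≡table (λ u v → encodeBool (E u v) ∷ encodeBool (R u v) ∷ []))

  L : ℕ
  L = ⌊log₂ length w ⌋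

  s : ℕ
  s = 4 * suc L

  -- The input contains a 𝟏 for each vertex and at least two separators, so its length is at least
  -- the counter bound `2 + (m + n)` and is below `2 ^ suc L`. The second `suc` in the exponent pays
  -- for the `suc` on the left.
  c<2ᵏ : suc (2 + (m + n)) < 2 ^ suc (suc L)
  c<2ᵏ = ≤-<-trans (≤-trans (s≤s short) (<2^suc-log (length w)))
    (^-monoʳ-< 2 (s≤s (s≤s z≤n)) (n<1+n (suc L)))
    where
    short : suc (suc (m + n)) ≤ length w
    short = subst₂ _≤_ (+-suc (suc m) n) (≡-sym (trans (cong length w≡word) (begin
      length (ones m ++ sep ∷ ones n ++ sep ∷ z)            ≡⟨ length-++ (ones m) ⟩
      length (ones m) + suc (length (ones n ++ sep ∷ z))
        ≡⟨ cong₂ (λ a b → a + suc b) (length-replicate m) (length-++ (ones n)) ⟩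
      m + suc (length (ones n) + suc (length z))
        ≡⟨ cong (λ a → m + suc (a + suc (length z))) (length-replicate n) ⟩
      m + suc (n + suc (length z))                          ≡⟨ +-suc m _ ⟩
      suc m + (n + suc (length z))                          ∎)))
      (+-monoʳ-≤ (suc m) (≤-trans (≤-reflexive (+-comm 1 n)) (+-monoʳ-≤ n (s≤s z≤n))))
      where
      open ≡-Reasoning
      z : List Sym
      z = table (λ i → pairs (E i) (R i)) ++ encodeℤ k

  -- The origin of the factor 4: with the counter limited to `L + 2` cells, `L + 3` has to be
  -- smaller than a multiple of `1 + L`, and at `L = 0` no smaller factor suffices.
  k<s : suc (suc (suc L)) < s
  k<s = subst (suc (suc (suc L)) <_) (≡-sym (*-suc 4 L)) (+-monoʳ-≤ 4 (m≤m+n L (3 * L)))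

  entry-at : Vertex m n → Vertex m n → List Sym
  entry-at a b = entry-of (same a b) (toCost (weight a b))

  diag : ∀ {n} → Fin n → List Sym → List Sym
  diag i d = tab (λ j → if does (i ≟ j) then d else forbidden)

  diag-constant : ∀ {n} (i : Fin n) → tab {n = n} (λ _ → forbidden) ≡ diag i forbidden
  diag-constant i = tab-cong λ j → same-branches (does (i ≟ j))
    where
    same-branches : ∀ b → forbidden ≡ (if b then forbidden else forbidden)
    same-branches true  = refl
    same-branches false = refl

  row-of : Vertex m n → List Sym
  row-of a = tab (λ i → entry-at a (first i)) ++ tab (λ i → entry-at a (second i)) ++
             tab (λ j → entry-at a (third j)) ++ [ sep ]

  first-row : ∀ i → row-of (first i) ≡
    diag i paid ++ diag i forbidden ++ tab (λ j → onBlue (E i j) (R i j)) ++ [ sep ]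
  first-row i = cong₂ _++_ (tab-cong λ j → case₁ (does (i ≟ j)))
    (cong₂ _++_ (diag-constant i) (cong (_++ [ sep ]) (tab-cong λ j → case₂ (E i j ∧ not (R i j)))))
    where
    case₁ : ∀ b → entry-of b (toCost (if b then just 1 else nothing)) ≡ (if b then paid else forbidden)
    case₁ true  = refl
    case₁ false = refl
    case₂ : ∀ b → entry-of false (toCost (if b then just 0 else nothing)) ≡ (if b then free else forbidden)
    case₂ true  = refl
    case₂ false = refl

  second-row : ∀ i → row-of (second i) ≡
    diag i free ++ diag i fixed ++ tab (λ j → onRed (E i j) (R i j)) ++ [ sep ]
  second-row i = cong₂ _++_ (tab-cong λ j → case₁ (does (i ≟ j)))
    (cong₂ _++_ (tab-cong λ j → case₂ (does (i ≟ j))) (cong (_++ [ sep ]) (tab-cong λ j → case₁ (R i j))))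
    where
    case₁ : ∀ b → entry-of false (toCost (if b then just 0 else nothing)) ≡ (if b then free else forbidden)
    case₁ true  = refl
    case₁ false = refl
    case₂ : ∀ b → entry-of b (toCost nothing) ≡ (if b then fixed else forbidden)
    case₂ true  = refl
    case₂ false = refl

  third-row : ∀ j → row-of (third j) ≡ (times m forbidden ++ times m free) ++ diag j fixed ++ [ sep ]
  third-row j = trans
    (cong₂ _++_ (tab-const m forbidden)
      (cong₂ _++_ (tab-const m free) (cong (_++ [ sep ]) (tab-cong λ i → case₂ (does (j ≟ i))))))
    (≡-sym (++-assoc (times m forbidden) _ _))
    where
    case₂ : ∀ b → entry-of b (toCost nothing) ≡ (if b then fixed else forbidden)
    case₂ true  = refl
    case₂ false = refl

  -- Rows and columns are cut into the same three kinds, so `tab-vertex` is applied twice: inside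
  -- each row and then to the list of rows.
  matrix : encodeMatrix (λ x y → entry-at (vertex x) (vertex y)) ≡
    tab (λ i → row-of (first i)) ++ tab (λ i → row-of (second i)) ++ tab (λ j → row-of (third j))
  matrix = trans (encodeMatrix≡table (λ x y → entry-at (vertex x) (vertex y)))
    (trans (tab-cong row) (tab-vertex row-of))
    where
    row : ∀ x → tab (λ y → entry-at (vertex x) (vertex y)) ++ [ sep ] ≡ row-of (vertex x)
    row x = begin
      tab (entry-at a ∘ vertex) ++ [ sep ]  ≡⟨ cong (_++ [ sep ]) (tab-vertex (entry-at a)) ⟩
      (as ++ bs ++ cs) ++ [ sep ]           ≡⟨ ++-assoc as _ _ ⟩
      as ++ (bs ++ cs) ++ [ sep ]           ≡⟨ cong (as ++_) (++-assoc bs _ _) ⟩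
      as ++ bs ++ cs ++ [ sep ]             ∎
      where
      open ≡-Reasoning
      a : Vertex m n
      a = vertex x
      as bs cs : List Sym
      as = tab (λ i → entry-at a (first i))
      bs = tab (λ i → entry-at a (second i))
      cs = tab (λ j → entry-at a (third j))

  m≤ : 2 + m ≤ 2 + (m + n)
  m≤ = s≤s (s≤s (m≤m+n m n))

  n≤ : n ≤ 2 + (m + n)
  n≤ = ≤-trans (m≤n+m n m) (m≤n+m (m + n) 2)

  output≡w′ : output k<s c<2ᵏ E R (encodeℤ k) (NoSep-encodeℤ k) m≤ n≤ ≡ w′
  output≡w′ = begin
    (times m (𝟏 ∷ 𝟏 ∷ []) ++ times n [ 𝟏 ] ++ [ sep ]) ++ blocks ++ tail
      ≡⟨ cong (_++ blocks ++ tail) (++-assoc (times m (𝟏 ∷ 𝟏 ∷ [])) _ _) ⟨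
    ((times m (𝟏 ∷ 𝟏 ∷ []) ++ times n [ 𝟏 ]) ++ [ sep ]) ++ blocks ++ tail
      ≡⟨ cong (λ z → (z ++ [ sep ]) ++ blocks ++ tail) (times-ones m n) ⟩
    (ones (m + (m + n)) ++ [ sep ]) ++ blocks ++ tail
      ≡⟨ ++-assoc (ones (m + (m + n))) _ _ ⟩
    ones (m + (m + n)) ++ sep ∷ blocks ++ tail
      ≡⟨ cong (λ z → ones (m + (m + n)) ++ sep ∷ z ++ tail) (trans matrix
           (cong₂ _++_ (tab-cong first-row) (cong₂ _++_ (tab-cong second-row) (tab-cong third-row)))) ⟨
    w′ ∎
    where
    open ≡-Reasoning
    blocks tail : List Sym
    blocks = tab (firstOut k<s c<2ᵏ E R (encodeℤ k) (NoSep-encodeℤ k) m≤ n≤) ++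
             tab (secondOut k<s c<2ᵏ E R (encodeℤ k) (NoSep-encodeℤ k) m≤ n≤) ++
             tab (thirdOut k<s c<2ᵏ E R (encodeℤ k) (NoSep-encodeℤ k) m≤ n≤)
    tail = encodeℤ k ++ sep ∷ encodeℤ k ++ slash ∷ encodeℕ 1

  main-computes : Run (compile main) s (initial (compile main) w) w′
  main-computes =
    let τ , τ≤s , e = main-run k<s c<2ᵏ E R (encodeℤ k) (NoSep-encodeℤ k) m≤ n≤ (s≤s z≤n)
    in subst₂ (λ v v′ → Run (compile main) s (initial (compile main) v) v′)
         (≡-sym w≡word) output≡w′ (compile-correct main e τ≤s)

theorem11 : LogspaceReducible ExactMatching 2S-RecovAP
theorem11 =
  reduce , (compile main , 4 , Correct.main-computes) ,
  λ G → let open RedBlueGraph G in Reduction.yes⇔ E R R⊆E k
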